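{- Let $G$ be a framework for a $3$-connected matroid $M$, and let $e$ be a loop-edge of $G$ at a vertex $v$ such that the cycle formed by $e$ is not balanced. If $e\in \mathrm{cl}_M(E(G-v))$, then the independent sets of $M$ are exactly the sets $I\subseteq E(G)$ such that $G[I]$ contains no balanced cycle and $G[I]$ contains at most one cycle.
   Context: For a graph $G$ and a vertex $v$, $\mathrm{loops}_G(v)$ denotes the set of loop-edges of $G$ at $v$. Graphs are finite and may have loops and parallel edges; a loop-edge forms a cycle of length one. For a set $X$ of edges, $G[X]$ is the subgraph of $G$ with edge-set $X$ and no isolated vertices. A graph $G$ is a framework for a matroid $M$ if (1) $E(G)=E(M)$; (2) $r_M(E(H))\le |V(H)|$ for each component $H$ of $G$; (3) for each vertex $v$ of $G$, $\mathrm{cl}_M(E(G-v))\subseteq E(G-v)\cup \mathrm{loops}_G(v)$; and (4) for each circuit $C$ of $M$, the subgraph $G[C]$ has at most two components. A cycle $C$ of $G$ is balanced (with respect to $M$) if $E(C)$ is a circuit of $M$. -}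

module Defs where

open import Data.Nat using (ℕ; zero; suc; _+_; _≤_; _<_)
open import Data.Fin using (Fin)
open import Data.Fin.Properties using (_≟_)
open import Data.Fin.Subset using (Subset; _∈_; _∉_; _⊆_; _⊂_; _∪_; ⁅_⁆; ∣_∣; ∁; ⊤)
open import Data.Fin.Subset.Properties using (_∈?_)
open import Data.Bool using (Bool; true; false; if_then_else_; not; _∨_)
open import Data.Product using (_×_; _,_; proj₁; proj₂; Σ; ∃; ∃-syntax)
open import Data.Sum using (_⊎_)
open import Data.List using (List; map; allFin)
open import Data.Nat.ListAction using (sum)
open import Data.Vec using (tabulate)
open import Relation.Nullary using (¬_; does)
open import Relation.Binary.PropositionalEquality using (_≡_)
open import Function.Bundles using (_⇔_)

record Matroid (m : ℕ) : Set where
  field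
    r        : Subset m → ℕ
    r-bound  : ∀ X → r X ≤ ∣ X ∣
    r-mono   : ∀ X Y → X ⊆ Y → r X ≤ r Y
    r-submod : ∀ X Y → r (X ∪ Y) + r (X Data.Fin.Subset.∩ Y) ≤ r X + r Y

module _ {m : ℕ} (M : Matroid m) where
  open Matroid M

  Independent : Subset m → Set
  Independent X = r X ≡ ∣ X ∣

  Circuit : Subset m → Set
  Circuit C = ¬ Independent C × (∀ D → D ⊂ C → Independent D)

  InCl : Subset m → Fin m → Set
  InCl X e = r (X ∪ ⁅ e ⁆) ≡ r X

  KSeparation : ℕ → Subset m → Set
  KSeparation k A = (k ≤ ∣ A ∣) × (k ≤ ∣ ∁ A ∣) × (r A + r (∁ A) < r ⊤ + k)

  ThreeConnected : Set
  ThreeConnected = ∀ k A → k < 3 → ¬ KSeparation k A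

-- Graphs with vertex set Fin n and edge set Fin m; loops and parallel
-- edges allowed.  Each edge has an (unordered) pair of ends.

record Graph (n m : ℕ) : Set where
  field
    ends : Fin m → Fin n × Fin n

module _ {n m : ℕ} (G : Graph n m) where
  open Graph G

  end₁ end₂ : Fin m → Fin n
  end₁ f = proj₁ (ends f)
  end₂ f = proj₂ (ends f)

  Incident : Fin n → Fin m → Set
  Incident x f = (end₁ f ≡ x) ⊎ (end₂ f ≡ x)

  incident? : Fin n → Fin m → Bool
  incident? x f = does (end₁ f ≟ x) ∨ does (end₂ f ≟ x)

  LoopAt : Fin n → Fin m → Set
  LoopAt v f = (end₁ f ≡ v) × (end₂ f ≡ v)

  EdgesMinus : Fin n → Subset m
  EdgesMinus v = tabulate (λ f → not (incident? v f))

  data Conn (X : Subset m) (x : Fin n) : Fin n → Set where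
    here  : Conn X x x
    step₁ : ∀ {f} → Conn X x (end₁ f) → f ∈ X → Conn X x (end₂ f)
    step₂ : ∀ {f} → Conn X x (end₂ f) → f ∈ X → Conn X x (end₁ f)

  b2n : Bool → ℕ
  b2n true  = 1
  b2n false = 0

  -- degree of x in G[C] (a loop contributes 2)
  deg : Subset m → Fin n → ℕ
  deg C x = sum (map (λ f → if does (f ∈? C)
                              then b2n (does (end₁ f ≟ x)) + b2n (does (end₂ f ≟ x))
                              else 0) (allFin m))

  -- the edge set C is (the edge set of) a cycle of G:
  -- G[C] is nonempty, connected and 2-regular
  Cycle : Subset m → Set
  Cycle C = (∃[ f ] f ∈ C)
          × (∀ f g → f ∈ C → g ∈ C → Conn C (end₁ f) (end₁ g))
          × (∀ x → (deg C x ≡ 0) ⊎ (deg C x ≡ 2))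

  ComponentVertices : Subset n → Set
  ComponentVertices S = ∃[ u ] (∀ w → (w ∈ S) ⇔ Conn ⊤ u w)

module _ {n m : ℕ} (G : Graph n m) (M : Matroid m) where
  open Matroid M

  -- G is a framework for M (condition (1) is built in: E(G) = E(M) = Fin m)
  record Framework : Set where
    field
      comp-rank : ∀ (S : Subset n) (F : Subset m) → ComponentVertices G S →
                  (∀ f → (f ∈ F) ⇔ (end₁ G f ∈ S)) → r F ≤ ∣ S ∣
      closure   : ∀ v f → InCl M (EdgesMinus G v) f →
                  (f ∈ EdgesMinus G v) ⊎ LoopAt G v f
      -- (4) for each circuit C of M, G[C] has at most two components
      circuit-comps : ∀ C → Circuit M C →
                  ∃[ a ] ∃[ b ] (∀ f x → f ∈ C → Incident G x f →
                                   Conn G C a x ⊎ Conn G C b x)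

  Balanced : Subset m → Set
  Balanced C = Cycle G C × Circuit M C

{-# OPTIONS --safe #-}

-- Cycles are the minimal nonempty edge sets without a vertex of degree 1, and circuits have no such
-- vertex by the closure axiom. By counting degrees, a circuit containing only one cycle is that cycle;
-- so a dependent set without balanced cycles contains two cycles.
--
-- Conversely it suffices that r(C ∪ e) ≤ |C| for every cycle C: two cycles in an independent set then
-- contradict submodularity, the set (C ∩ D) ∪ e being independent.
-- Adding to a vertex set an adjacent vertex raises the rank of the edges inside it, hence r(E[S]) ≤ |S|
-- for every nonempty S in one component; this settles the cycles through v. A circuit through e in
-- E(G - v) ∪ e has {e} as a component, so e is spanned by the edges of a single component of G - v, and
-- the same growth argument gives r(E[S] ∪ e) ≤ |S| for S inside that component. Any other component of
-- G - v yields a 2-separation unless it meets at most one edge f; if f forms a cycle it is an isolated loop,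
-- for which the theorem's hypothesis holds as well, and comparing the two loops gives r{e,f} ≤ 1.

module Submission where

open import Defs
open import Data.Bool using (true; false; if_then_else_; not)
open import Data.Empty using (⊥-elim)
open import Data.Fin using (Fin; zero; suc)
open import Data.Fin.Properties using (_≟_; any?; all?)
open import Data.Fin.Subset using (Subset; Nonempty; ⊥; ⊤; _∈_; _∉_; _⊆_; _⊂_; _∪_; _∩_; _─_; _-_; ∁; ⁅_⁆; ∣_∣)
open import Data.Fin.Subset.Properties
open import Data.List using (map; allFin)
open import Data.List.Properties using (map-tabulate)
import Data.List as List
open import Data.Nat using (ℕ; zero; suc; _+_; _≤_; _<_; z≤n; s≤s)
import Data.Nat.ListAction as ListAction
open import Data.Nat.Properties hiding (_≟_)
import Data.Nat.Properties as ℕ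
open import Data.Product using (_×_; _,_; proj₁; proj₂; ∃-syntax)
open import Data.Sum using (_⊎_; inj₁; inj₂; [_,_]′)
open import Data.Vec using (_∷_; []; tabulate; here; there)
open import Data.Vec.Properties using ([]=⇒lookup; lookup⇒[]=; lookup∘tabulate)
open import Function using (_∘_; id)
open import Function.Bundles using (_⇔_; mk⇔; Equivalence)
open import Relation.Nullary using (¬_; Dec; yes; no; does)
open import Relation.Nullary.Decidable using (dec-true; _×-dec_; _⊎-dec_; ¬?)
open import Relation.Binary.PropositionalEquality using (_≡_; _≢_; refl; sym; trans; cong; cong₂; subst; subst₂; module ≡-Reasoning)
open import Algebra.Properties.CommutativeMonoid.Sum +-0-commutativeMonoid using (sum; ∑-distrib-+; ∑-comm; sum-cong-≗)

-- Finite subsets and their cardinalities.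

true-does : ∀ {a} {A : Set a} (A? : Dec A) → does A? ≡ true → A
true-does (yes a) _ = a

filterFin : ∀ {k} {P : Fin k → Set} → (∀ x → Dec (P x)) → Subset k
filterFin P? = tabulate (does ∘ P?)

∈-filterFin⁺ : ∀ {k} {P : Fin k → Set} (P? : ∀ x → Dec (P x)) {x} → P x → x ∈ filterFin P?
∈-filterFin⁺ P? {x} px = lookup⇒[]= x _ (trans (lookup∘tabulate (does ∘ P?) x) (dec-true (P? x) px))

∈-filterFin⁻ : ∀ {k} {P : Fin k → Set} (P? : ∀ x → Dec (P x)) {x} → x ∈ filterFin P? → P x
∈-filterFin⁻ P? {x} x∈ =
  true-does (P? x) (trans (sym (lookup∘tabulate (does ∘ P?) x)) ([]=⇒lookup x∈))

∪-least : ∀ {k} (p q : Subset k) {s} → p ⊆ s → q ⊆ s → p ∪ q ⊆ s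
∪-least p q p⊆s q⊆s = [ p⊆s , q⊆s ]′ ∘ x∈p∪q⁻ p q

∪-monoˡ-⊆ : ∀ {k} (p q s : Subset k) → p ⊆ q → p ∪ s ⊆ q ∪ s
∪-monoˡ-⊆ p q s p⊆q = ∪-least p s (p⊆p∪q s ∘ p⊆q) (q⊆p∪q q s)

⁅⁆-⊆ : ∀ {k} {x : Fin k} {p} → x ∈ p → ⁅ x ⁆ ⊆ p
⁅⁆-⊆ {p = p} x∈p y∈ = subst (_∈ p) (sym (x∈⁅y⁆⇒x≡y _ y∈)) x∈p

x∈p─q⇒x∉q : ∀ {k} {x : Fin k} (p q : Subset k) → x ∈ p ─ q → x ∉ q
x∈p─q⇒x∉q (_ ∷ p) (_ ∷ q) (there x∈) (there x∈q) = x∈p─q⇒x∉q p q x∈ x∈q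
x∈p─q⇒x∉q (_ ∷ p) (true ∷ q) () here

x∈p-y⇒x≢y : ∀ {k} {x y : Fin k} (p : Subset k) → x ∈ p - y → x ≢ y
x∈p-y⇒x≢y p x∈ refl = x∈p─q⇒x∉q p _ x∈ (x∈⁅x⁆ _)

x∉p-x : ∀ {k} (x : Fin k) (p : Subset k) → x ∉ p - x
x∉p-x x p x∈ = x∈p-y⇒x≢y p x∈ refl

p-x⊆p : ∀ {k} (p : Subset k) (x : Fin k) → p - x ⊆ p
p-x⊆p p x = p─q⊆p p ⁅ x ⁆

p⊆p-x∪x : ∀ {k} (p : Subset k) (x : Fin k) → p ⊆ (p - x) ∪ ⁅ x ⁆
p⊆p-x∪x p x {y} y∈p with y ≟ x
... | yes refl = q⊆p∪q (p - x) ⁅ x ⁆ (x∈⁅x⁆ x)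
... | no y≢x = p⊆p∪q ⁅ x ⁆ (x∈p∧x≢y⇒x∈p-y y∈p y≢x)

Empty⇒∣∣≡0 : ∀ {k} {p : Subset k} → ¬ Nonempty p → ∣ p ∣ ≡ 0
Empty⇒∣∣≡0 {k} ¬ne = trans (cong ∣_∣ (Empty-unique ¬ne)) (∣⊥∣≡0 k)

∣p-x∣ : ∀ {k} {x : Fin k} {p} → x ∈ p → ∣ p ∣ ≡ suc ∣ p - x ∣
∣p-x∣ {p = true ∷ p} here = cong suc (cong ∣_∣ (sym (p─⊥≡p p)))
∣p-x∣ {p = true ∷ p} (there x∈p) = cong suc (∣p-x∣ x∈p)
∣p-x∣ {p = false ∷ p} (there x∈p) = ∣p-x∣ x∈p

∣p∪x∣ : ∀ {k} {x : Fin k} {p} → x ∉ p → ∣ p ∪ ⁅ x ⁆ ∣ ≡ suc ∣ p ∣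
∣p∪x∣ {x = zero}  {true ∷ p}  x∉p = ⊥-elim (x∉p here)
∣p∪x∣ {x = zero}  {false ∷ p} x∉p = cong suc (cong ∣_∣ (∪-identityʳ p))
∣p∪x∣ {x = suc x} {true ∷ p}  x∉p = cong suc (∣p∪x∣ (x∉p ∘ there))
∣p∪x∣ {x = suc x} {false ∷ p} x∉p = ∣p∪x∣ (x∉p ∘ there)

∣p∪q∣+∣p∩q∣ : ∀ {k} (p q : Subset k) → ∣ p ∪ q ∣ + ∣ p ∩ q ∣ ≡ ∣ p ∣ + ∣ q ∣
∣p∪q∣+∣p∩q∣ [] [] = refl
∣p∪q∣+∣p∩q∣ (true ∷ p)  (true ∷ q)  = cong suc (trans (+-suc ∣ p ∪ q ∣ _) (trans (cong suc (∣p∪q∣+∣p∩q∣ p q)) (sym (+-suc ∣ p ∣ _))))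
∣p∪q∣+∣p∩q∣ (true ∷ p)  (false ∷ q) = cong suc (∣p∪q∣+∣p∩q∣ p q)
∣p∪q∣+∣p∩q∣ (false ∷ p) (true ∷ q)  = trans (cong suc (∣p∪q∣+∣p∩q∣ p q)) (sym (+-suc ∣ p ∣ _))
∣p∪q∣+∣p∩q∣ (false ∷ p) (false ∷ q) = ∣p∪q∣+∣p∩q∣ p q

p⊆q⇒∣q∣≡∣p∣+∣q─p∣ : ∀ {k} {p q : Subset k} → p ⊆ q → ∣ q ∣ ≡ ∣ p ∣ + ∣ q ─ p ∣
p⊆q⇒∣q∣≡∣p∣+∣q─p∣ {p = []}        {[]}        _   = refl
p⊆q⇒∣q∣≡∣p∣+∣q─p∣ {p = true ∷ p}  {true ∷ q}  p⊆q = cong suc (p⊆q⇒∣q∣≡∣p∣+∣q─p∣ (drop-∷-⊆ p⊆q))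
p⊆q⇒∣q∣≡∣p∣+∣q─p∣ {p = true ∷ p}  {false ∷ q} p⊆q with () ← p⊆q here
p⊆q⇒∣q∣≡∣p∣+∣q─p∣ {p = false ∷ p} {true ∷ q}  p⊆q = trans (cong suc (p⊆q⇒∣q∣≡∣p∣+∣q─p∣ (drop-∷-⊆ p⊆q))) (sym (+-suc ∣ p ∣ _))
p⊆q⇒∣q∣≡∣p∣+∣q─p∣ {p = false ∷ p} {false ∷ q} p⊆q = p⊆q⇒∣q∣≡∣p∣+∣q─p∣ (drop-∷-⊆ p⊆q)

x∈p⇒0<∣p∣ : ∀ {k} {x : Fin k} {p} → x ∈ p → 0 < ∣ p ∣
x∈p⇒0<∣p∣ x∈p = subst (0 <_) (sym (∣p-x∣ x∈p)) (s≤s z≤n)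

two∈⇒2≤∣p∣ : ∀ {k} {x y : Fin k} {p} → x ∈ p → y ∈ p → x ≢ y → 2 ≤ ∣ p ∣
two∈⇒2≤∣p∣ x∈p y∈p x≢y =
  subst (2 ≤_) (sym (∣p-x∣ x∈p)) (s≤s (x∈p⇒0<∣p∣ (x∈p∧x≢y⇒x∈p-y y∈p (x≢y ∘ sym))))

∣p∣≱2⇒≡ : ∀ {k} {x y : Fin k} {p} → ¬ (2 ≤ ∣ p ∣) → x ∈ p → y ∈ p → x ≡ y
∣p∣≱2⇒≡ {x = x} {y} small x∈p y∈p with x ≟ y
... | yes x≡y = x≡y
... | no x≢y = ⊥-elim (small (two∈⇒2≤∣p∣ x∈p y∈p x≢y))

⊈⇒∃∈∖ : ∀ {k} (p q : Subset k) → ¬ (p ⊆ q) → ∃[ x ] x ∈ p × x ∉ q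
⊈⇒∃∈∖ p q p⊈q with any? (λ x → x ∈? p ×-dec ¬? (x ∈? q))
... | yes w = w
... | no ¬w = ⊥-elim (p⊈q λ {x} x∈p → case-∈ x x∈p)
  where
  case-∈ : ∀ x → x ∈ p → x ∈ q
  case-∈ x x∈p with x ∈? q
  ... | yes x∈q = x∈q
  ... | no x∉q = ⊥-elim (¬w (x , x∈p , x∉q))

⊆∧⊉⇒⊂ : ∀ {k} {p q : Subset k} → p ⊆ q → ¬ (q ⊆ p) → p ⊂ q
⊆∧⊉⇒⊂ {p = p} {q} p⊆q q⊈p = p⊆q , ⊈⇒∃∈∖ q p q⊈p

-- Sums over Fin k

sum≡0 : ∀ {k} (t : Fin k → ℕ) → sum t ≡ 0 → ∀ i → t i ≡ 0
sum≡0 t eq zero    = m+n≡0⇒m≡0 (t zero) eq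
sum≡0 t eq (suc i) = sum≡0 (t ∘ suc) (m+n≡0⇒n≡0 (t zero) eq) i

all≡0⇒sum≡0 : ∀ {k} (t : Fin k → ℕ) → (∀ i → t i ≡ 0) → sum t ≡ 0
all≡0⇒sum≡0 {zero}  t z = refl
all≡0⇒sum≡0 {suc k} t z = cong₂ _+_ (z zero) (all≡0⇒sum≡0 (t ∘ suc) (z ∘ suc))

sum≡1 : ∀ {k} (t : Fin k → ℕ) → sum t ≡ 1 → ∃[ i ] t i ≡ 1 × (∀ j → j ≢ i → t j ≡ 0)
sum≡1 {suc k} t eq with t zero in t0
... | zero = let i , ti , rest = sum≡1 (t ∘ suc) eq in
  suc i , ti , λ { zero _ → t0 ; (suc j) j≢ → rest j (j≢ ∘ cong suc) }
... | suc zero = zero , t0 ,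
  λ { zero j≢ → ⊥-elim (j≢ refl) ; (suc j) _ → sum≡0 (t ∘ suc) (ℕ.suc-injective eq) j }

sum-mono-≤ : ∀ {k} {s t : Fin k → ℕ} → (∀ i → s i ≤ t i) → sum s ≤ sum t
sum-mono-≤ {zero}  s≤t = z≤n
sum-mono-≤ {suc k} s≤t = +-mono-≤ (s≤t zero) (sum-mono-≤ (s≤t ∘ suc))

sum-tight : ∀ {k} {s t : Fin k → ℕ} → (∀ i → s i ≤ t i) → sum t ≤ sum s → ∀ i → s i ≡ t i
sum-tight {suc k} {s} {t} s≤t le zero = ≤-antisym (s≤t zero)
  (+-cancelʳ-≤ _ _ _ (≤-trans (+-monoʳ-≤ (t zero) (sum-mono-≤ (s≤t ∘ suc))) le))
sum-tight {suc k} {s} {t} s≤t le (suc i) = sum-tight (s≤t ∘ suc)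
  (+-cancelˡ-≤ _ _ _ (≤-trans (+-monoˡ-≤ _ (s≤t zero)) le)) i

sum-δ : ∀ {k a b} (G : Graph a b) (y : Fin k) → sum (λ x → b2n G (does (y ≟ x))) ≡ 1
sum-δ {suc k} G zero = cong suc (all≡0⇒sum≡0 {k} (λ _ → 0) λ _ → refl)
sum-δ G (suc y) = sum-δ G y

χ : ∀ {k} → Subset k → Fin k → ℕ
χ p x = if does (x ∈? p) then 1 else 0

∣p∣≡sum-χ : ∀ {k} (p : Subset k) → ∣ p ∣ ≡ sum (χ p)
∣p∣≡sum-χ [] = refl
∣p∣≡sum-χ (true ∷ p) = cong suc (∣p∣≡sum-χ p)
∣p∣≡sum-χ (false ∷ p) = ∣p∣≡sum-χ p

sum-map-allFin : ∀ {k} (t : Fin k → ℕ) → ListAction.sum (map t (allFin k)) ≡ sum t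
sum-map-allFin {k} t = trans (cong ListAction.sum (map-tabulate id t)) (go t)
  where
  go : ∀ {j} (t : Fin j → ℕ) → ListAction.sum (List.tabulate t) ≡ sum t
  go {zero}  t = refl
  go {suc j} t = cong (t zero +_) (go (t ∘ suc))

-- Rank, closure, independence and circuits of a matroid.

module MatroidProperties {m : ℕ} (M : Matroid m) where
  open Matroid M

  Empty⇒r≡0 : ∀ {X} → ¬ Nonempty X → r X ≡ 0
  Empty⇒r≡0 {X} ¬ne = n≤0⇒n≡0 (subst (r X ≤_) (Empty⇒∣∣≡0 ¬ne) (r-bound X))

  r-⁅⁆ : ∀ x → r ⁅ x ⁆ ≤ 1
  r-⁅⁆ x = subst (r ⁅ x ⁆ ≤_) (∣⁅x⁆∣≡1 x) (r-bound ⁅ x ⁆)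

  r-∪ : ∀ X Y → r (X ∪ Y) ≤ r X + r Y
  r-∪ X Y = ≤-trans (m≤m+n _ _) (r-submod X Y)

  r-∪-⁅⁆ : ∀ X x → r (X ∪ ⁅ x ⁆) ≤ suc (r X)
  r-∪-⁅⁆ X x = ≤-trans (r-∪ X ⁅ x ⁆)
    (subst (r X + r ⁅ x ⁆ ≤_) (+-comm (r X) 1) (+-monoʳ-≤ (r X) (r-⁅⁆ x)))

  InCl-≤ : ∀ {X x} → r (X ∪ ⁅ x ⁆) ≤ r X → InCl M X x
  InCl-≤ {X} {x} le = ≤-antisym le (r-mono X _ (p⊆p∪q ⁅ x ⁆))

  -- Submodularity of `Y` with `X ∪ ⁅ x ⁆`, whose intersection contains `X`.
  InCl-mono : ∀ {X Y x} → X ⊆ Y → InCl M X x → InCl M Y x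
  InCl-mono {X} {Y} {x} X⊆Y x∈clX = InCl-≤ (+-cancelʳ-≤ (r X) _ _ (begin
    r (Y ∪ ⁅ x ⁆) + r X                            ≤⟨ +-mono-≤ (r-mono _ _ Y∪x⊆) (r-mono _ _ X⊆∩) ⟩
    r (Y ∪ (X ∪ ⁅ x ⁆)) + r (Y ∩ (X ∪ ⁅ x ⁆))      ≤⟨ r-submod Y (X ∪ ⁅ x ⁆) ⟩
    r Y + r (X ∪ ⁅ x ⁆)                            ≡⟨ cong (r Y +_) x∈clX ⟩
    r Y + r X                                      ∎))
    where
    open ≤-Reasoning
    Y∪x⊆ : Y ∪ ⁅ x ⁆ ⊆ Y ∪ (X ∪ ⁅ x ⁆)
    Y∪x⊆ = ∪-least Y ⁅ x ⁆ (p⊆p∪q _) (q⊆p∪q Y _ ∘ q⊆p∪q X ⁅ x ⁆)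
    X⊆∩ : X ⊆ Y ∩ (X ∪ ⁅ x ⁆)
    X⊆∩ z = x∈p∩q⁺ (X⊆Y z , p⊆p∪q ⁅ x ⁆ z)

  ¬InCl⇒r-< : ∀ {X x} → ¬ InCl M X x → suc (r X) ≤ r (X ∪ ⁅ x ⁆)
  ¬InCl⇒r-< {X} {x} x∉cl = ≤∧≢⇒< (r-mono X _ (p⊆p∪q ⁅ x ⁆)) (x∉cl ∘ sym)

  Independent-⊆ : ∀ {X Y} → X ⊆ Y → Independent M Y → Independent M X
  Independent-⊆ {X} {Y} X⊆Y indY = ≤-antisym (r-bound X) (+-cancelʳ-≤ ∣ Y ─ X ∣ _ _ (begin
    ∣ X ∣ + ∣ Y ─ X ∣   ≡⟨ p⊆q⇒∣q∣≡∣p∣+∣q─p∣ X⊆Y ⟨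
    ∣ Y ∣               ≡⟨ indY ⟨
    r Y                 ≤⟨ r-mono _ _ Y⊆ ⟩
    r (X ∪ (Y ─ X))     ≤⟨ r-∪ X (Y ─ X) ⟩
    r X + r (Y ─ X)     ≤⟨ +-monoʳ-≤ (r X) (r-bound (Y ─ X)) ⟩
    r X + ∣ Y ─ X ∣     ∎))
    where
    open ≤-Reasoning
    Y⊆ : Y ⊆ X ∪ (Y ─ X)
    Y⊆ {y} y∈Y with y ∈? X
    ... | yes y∈X = p⊆p∪q (Y ─ X) y∈X
    ... | no y∉X = q⊆p∪q X (Y ─ X) (x∈p∧x∉q⇒x∈p─q y∈Y y∉X)

  Independent-∪-⁅⁆ : ∀ {X x} → Independent M X → x ∉ X → ¬ InCl M X x → Independent M (X ∪ ⁅ x ⁆)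
  Independent-∪-⁅⁆ {X} {x} indX x∉X x∉cl = ≤-antisym (r-bound _)
    (subst (_≤ r (X ∪ ⁅ x ⁆)) (trans (cong suc indX) (sym (∣p∪x∣ x∉X))) (¬InCl⇒r-< x∉cl))

  Independent-remove : ∀ {X x} → x ∈ X → Independent M (X - x) → ¬ InCl M (X - x) x → Independent M X
  Independent-remove {X} {x} x∈X ind x∉cl =
    Independent-⊆ (p⊆p-x∪x X x) (Independent-∪-⁅⁆ ind (x∉p-x x X) x∉cl)

  Independent? : ∀ X → Dec (Independent M X)
  Independent? X = r X ℕ.≟ ∣ X ∣

  private
    -- Remove one element: by monotonicity of closure the rest is irredundant, hence independent by
    -- induction, and it does not span the removed element. `k` bounds the size of `Z` and drives
    -- the recursion.
    irredundant⇒Independent : ∀ k Z → ∣ Z ∣ ≤ k → (∀ z → z ∈ Z → ¬ InCl M (Z - z) z) → Independent M Z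
    irredundant⇒Independent zero Z ∣Z∣≤0 _ = ≤-antisym (r-bound Z) (≤-trans ∣Z∣≤0 z≤n)
    irredundant⇒Independent (suc k) Z ∣Z∣≤ irr with nonempty? Z
    ... | no ¬ne = ≤-antisym (r-bound Z) (≤-trans (≤-reflexive (Empty⇒∣∣≡0 ¬ne)) z≤n)
    ... | yes (z , z∈Z) = Independent-remove z∈Z
      (irredundant⇒Independent k (Z - z) (≤-pred (subst (_≤ suc k) (∣p-x∣ z∈Z) ∣Z∣≤))
        λ y y∈ y∈cl → irr y (p-x⊆p Z z y∈) (InCl-mono (remove-mono y) y∈cl))
      (irr z z∈Z)
      where
      remove-mono : ∀ y → (Z - z) - y ⊆ Z - y
      remove-mono y a∈ = x∈p∧x≢y⇒x∈p-y (p-x⊆p Z z (p-x⊆p (Z - z) y a∈)) (x∈p-y⇒x≢y (Z - z) a∈)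

  -- Elements of `X` are deleted as long as the rest still spans `e`. When no further deletion is
  -- possible, what is left forms a circuit together with `e`.
  circuit-through : ∀ {X e} → r ⁅ e ⁆ ≡ 1 → e ∉ X → InCl M X e →
                    ∃[ Y ] Y ⊆ X × Circuit M (Y ∪ ⁅ e ⁆)
  circuit-through {X₀} {e} re≡1 = λ e∉ e∈cl → go _ X₀ ≤-refl e∉ e∈cl
    where
    go : ∀ k X → ∣ X ∣ ≤ k → e ∉ X → InCl M X e → ∃[ Y ] Y ⊆ X × Circuit M (Y ∪ ⁅ e ⁆)
    go k X ∣X∣≤ e∉X e∈cl with any? (λ x → x ∈? X ×-dec (r ((X - x) ∪ ⁅ e ⁆) ℕ.≟ r (X - x)))
    go zero X ∣X∣≤ e∉X e∈cl | yes (x , x∈X , _) with () ← ≤-trans (x∈p⇒0<∣p∣ x∈X) ∣X∣≤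
    go (suc k) X ∣X∣≤ e∉X e∈cl | yes (x , x∈X , e∈cl′) =
      let Y , Y⊆ , circ = go k (X - x) (≤-pred (subst (_≤ suc k) (∣p-x∣ x∈X) ∣X∣≤)) (e∉X ∘ p-x⊆p X x) e∈cl′
      in Y , p-x⊆p X x ∘ Y⊆ , circ
    go k X ∣X∣≤ e∉X e∈cl | no minimal = X , id , dependent , proper
      where
      e∉cl : ∀ x → x ∈ X → ¬ InCl M (X - x) e
      e∉cl x x∈X e∈ = minimal (x , x∈X , e∈)

      dependent : ¬ Independent M (X ∪ ⁅ e ⁆)
      dependent ind = <-irrefl refl (begin-strict
        r X              ≤⟨ r-bound X ⟩
        ∣ X ∣            <⟨ ≤-refl ⟩
        suc ∣ X ∣        ≡⟨ ∣p∪x∣ e∉X ⟨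
        ∣ X ∪ ⁅ e ⁆ ∣    ≡⟨ ind ⟨
        r (X ∪ ⁅ e ⁆)    ≡⟨ e∈cl ⟩
        r X              ∎)
        where open ≤-Reasoning

      indX : Independent M X
      -- If `X - x` spanned `x`, it would have the rank of `X ∪ ⁅ e ⁆` and so span `e`, against
      -- minimality.
      indX = irredundant⇒Independent _ X ≤-refl λ x x∈X x∈cl → e∉cl x x∈X (InCl-≤ (begin
        r ((X - x) ∪ ⁅ e ⁆)  ≤⟨ r-mono _ _ (∪-monoˡ-⊆ (X - x) X ⁅ e ⁆ (p-x⊆p X x)) ⟩
        r (X ∪ ⁅ e ⁆)        ≡⟨ e∈cl ⟩
        r X                  ≤⟨ r-mono _ _ (p⊆p-x∪x X x) ⟩
        r ((X - x) ∪ ⁅ x ⁆)  ≡⟨ x∈cl ⟩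
        r (X - x)            ∎))
        where open ≤-Reasoning

      proper : ∀ D → D ⊂ X ∪ ⁅ e ⁆ → Independent M D
      proper D (D⊆ , y , y∈ , y∉D) with x∈p∪q⁻ X ⁅ e ⁆ y∈
      ... | inj₂ y∈e = Independent-⊆ D⊆X indX
        where
        D⊆X : D ⊆ X
        D⊆X d∈D with x∈p∪q⁻ X ⁅ e ⁆ (D⊆ d∈D)
        ... | inj₁ d∈X = d∈X
        ... | inj₂ d∈e = ⊥-elim (y∉D (subst (_∈ D) (trans (x∈⁅y⁆⇒x≡y e d∈e) (sym (x∈⁅y⁆⇒x≡y e y∈e))) d∈D))
      ... | inj₁ y∈X = Independent-⊆ D⊆′
        (Independent-∪-⁅⁆ (Independent-⊆ (p-x⊆p X y) indX) (e∉X ∘ p-x⊆p X y) (e∉cl y y∈X))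
        where
        D⊆′ : D ⊆ (X - y) ∪ ⁅ e ⁆
        D⊆′ d∈D with x∈p∪q⁻ X ⁅ e ⁆ (D⊆ d∈D)
        ... | inj₁ d∈X = p⊆p∪q ⁅ e ⁆ (x∈p∧x≢y⇒x∈p-y d∈X λ { refl → y∉D d∈D })
        ... | inj₂ d∈e = q⊆p∪q (X - y) ⁅ e ⁆ d∈e

-- Incidence, connectivity, degrees and cycles of a graph.

module GraphProperties {n m : ℕ} (G : Graph n m) where

  otherEnd : ∀ {x f} → Incident G x f → ∃[ y ] Incident G y f × (x ≡ y → LoopAt G x f)
  otherEnd {f = f} (inj₁ refl) = end₂ G f , inj₂ refl , λ eq → refl , sym eq
  otherEnd {f = f} (inj₂ refl) = end₁ G f , inj₁ refl , λ eq → sym eq , refl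

  ∈EdgesMinus⁺ : ∀ {v f} → ¬ Incident G v f → f ∈ EdgesMinus G v
  ∈EdgesMinus⁺ {v} {f} ¬inc = lookup⇒[]= f _ (trans (lookup∘tabulate _ f) notInc)
    where
    notInc : not (incident? G v f) ≡ true
    notInc with end₁ G f ≟ v | end₂ G f ≟ v
    ... | yes p | _     = ⊥-elim (¬inc (inj₁ p))
    ... | no _  | yes q = ⊥-elim (¬inc (inj₂ q))
    ... | no _  | no _  = refl

  ∈EdgesMinus⁻ : ∀ {v f} → f ∈ EdgesMinus G v → ¬ Incident G v f
  ∈EdgesMinus⁻ {v} {f} f∈ = absurd (trans (sym (lookup∘tabulate _ f)) ([]=⇒lookup f∈))
    where
    absurd : not (incident? G v f) ≡ true → ¬ Incident G v f
    absurd eq with end₁ G f ≟ v | end₂ G f ≟ v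
    absurd ()  | yes _ | _
    absurd ()  | no _  | yes _
    ... | no ¬p | no ¬q = [ ¬p , ¬q ]′

  Incident? : ∀ x f → Dec (Incident G x f)
  Incident? x f = (end₁ G f ≟ x) ⊎-dec (end₂ G f ≟ x)

  -- Connectivity

  Conn-trans : ∀ {X x y z} → Conn G X x y → Conn G X y z → Conn G X x z
  Conn-trans p here         = p
  Conn-trans p (step₁ q f∈) = step₁ (Conn-trans p q) f∈
  Conn-trans p (step₂ q f∈) = step₂ (Conn-trans p q) f∈

  Conn-sym : ∀ {X x y} → Conn G X x y → Conn G X y x
  Conn-sym here         = here
  Conn-sym (step₁ p f∈) = Conn-trans (step₂ here f∈) (Conn-sym p)
  Conn-sym (step₂ p f∈) = Conn-trans (step₁ here f∈) (Conn-sym p)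

  Conn-mono : ∀ {X Y x y} → X ⊆ Y → Conn G X x y → Conn G Y x y
  Conn-mono X⊆Y here         = here
  Conn-mono X⊆Y (step₁ p f∈) = step₁ (Conn-mono X⊆Y p) (X⊆Y f∈)
  Conn-mono X⊆Y (step₂ p f∈) = step₂ (Conn-mono X⊆Y p) (X⊆Y f∈)

  Conn-edge : ∀ {X x y f} → f ∈ X → Incident G x f → Incident G y f → Conn G X x y
  Conn-edge f∈ (inj₁ refl) (inj₁ refl) = here
  Conn-edge f∈ (inj₁ refl) (inj₂ refl) = step₁ here f∈
  Conn-edge f∈ (inj₂ refl) (inj₁ refl) = step₂ here f∈
  Conn-edge f∈ (inj₂ refl) (inj₂ refl) = here

  -- The closure condition also receives the walk to `x`. This lets it use facts about reachable
  -- vertices, as when a walk is transferred to another edge set.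
  Conn-invariant : ∀ {X s} (P : Fin n → Set) → P s →
                   (∀ {f x y} → Conn G X s x → f ∈ X → Incident G x f → Incident G y f → P x → P y) →
                   ∀ {w} → Conn G X s w → P w
  Conn-invariant P Ps closed here = Ps
  Conn-invariant P Ps closed (step₁ p f∈) =
    closed p f∈ (inj₁ refl) (inj₂ refl) (Conn-invariant P Ps closed p)
  Conn-invariant P Ps closed (step₂ p f∈) =
    closed p f∈ (inj₂ refl) (inj₁ refl) (Conn-invariant P Ps closed p)

  -- The vertex set of a component of the spanning subgraph with edge set `X`; an isolated vertex
  -- has a singleton class.
  Class : Subset m → Fin n → Subset n → Set
  Class X s K = ∀ w → (w ∈ K) ⇔ Conn G X s w

  Class⇒Conn : ∀ {X s K} → Class X s K → ∀ {w} → w ∈ K → Conn G X s w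
  Class⇒Conn K-class = Equivalence.to (K-class _)

  Conn⇒Class : ∀ {X s K} → Class X s K → ∀ {w} → Conn G X s w → w ∈ K
  Conn⇒Class K-class = Equivalence.from (K-class _)

  Class-closed : ∀ {X s K f x y} → Class X s K → f ∈ X → Incident G x f → Incident G y f → x ∈ K → y ∈ K
  Class-closed K-class f∈ x~f y~f x∈ =
    Conn⇒Class K-class (Conn-trans (Class⇒Conn K-class x∈) (Conn-edge f∈ x~f y~f))

  Crossing : Subset m → Subset n → Fin m → Fin n → Set
  Crossing X S f y = f ∈ X × Incident G y f × y ∉ S × ∃[ z ] Incident G z f × z ∈ S

  crossing : ∀ {X S s x} → s ∈ S → x ∉ S → Conn G X s x →
             ∃[ f ] ∃[ y ] Crossing X S f y × Conn G X s y
  crossing s∈ x∉ here = ⊥-elim (x∉ s∈)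
  crossing {S = S} s∈ x∉ (step₁ {f} p f∈) with end₁ G f ∈? S
  ... | yes z∈ = f , _ , (f∈ , inj₂ refl , x∉ , _ , inj₁ refl , z∈) , step₁ p f∈
  ... | no z∉  = crossing s∈ z∉ p
  crossing {S = S} s∈ x∉ (step₂ {f} p f∈) with end₂ G f ∈? S
  ... | yes z∈ = f , _ , (f∈ , inj₁ refl , x∉ , _ , inj₂ refl , z∈) , step₂ p f∈
  ... | no z∉  = crossing s∈ z∉ p

  -- Starting from `⁅ s ⁆`, the far end of an edge leaving the set is added until no edge leaves.
  -- `k` bounds the number of vertices still outside.
  class : ∀ X s → ∃[ K ] Class X s K
  class X s = go n ⁅ s ⁆ (m≤n+m n _) (x∈⁅x⁆ s) λ w∈ → subst (Conn G X s) (sym (x∈⁅y⁆⇒x≡y s w∈)) here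
    where
    go : ∀ k K → n ≤ ∣ K ∣ + k → s ∈ K → (∀ {w} → w ∈ K → Conn G X s w) → ∃[ K′ ] Class X s K′
    go k K n≤ s∈K sound
      with any? (λ f → any? λ y → f ∈? X ×-dec Incident? y f ×-dec ¬? (y ∈? K) ×-dec
                       any? λ z → Incident? z f ×-dec z ∈? K)
    ... | no closed = K , λ w → mk⇔ sound (complete w)
      where
      complete : ∀ w → Conn G X s w → w ∈ K
      complete w p with w ∈? K
      ... | yes w∈ = w∈
      ... | no w∉ = let f , y , cr , _ = crossing s∈K w∉ p in ⊥-elim (closed (f , y , cr))
    go zero K n≤ s∈K sound | yes (f , y , _ , _ , y∉ , _) =
      ⊥-elim (y∉ (subst (y ∈_) (sym (∣p∣≡n⇒p≡⊤ (≤-antisym (∣p∣≤n K) (subst (n ≤_) (+-identityʳ _) n≤)))) ∈⊤))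
    go (suc k) K n≤ s∈K sound | yes (f , y , f∈ , y~f , y∉ , z , z~f , z∈) =
      go k (K ∪ ⁅ y ⁆) (subst (n ≤_) (trans (+-suc _ k) (cong (_+ k) (sym (∣p∪x∣ y∉)))) n≤)
        (p⊆p∪q ⁅ y ⁆ s∈K) λ w∈ → [ sound , (λ w≡y → subst (Conn G X s) (sym (x∈⁅y⁆⇒x≡y y w≡y))
                                     (Conn-trans (sound z∈) (Conn-edge f∈ z~f y~f))) ]′ (x∈p∪q⁻ K ⁅ y ⁆ w∈)

  -- Degrees

  endCount : Fin m → Fin n → ℕ
  endCount f x = b2n G (does (end₁ G f ≟ x)) + b2n G (does (end₂ G f ≟ x))

  degTerm : Subset m → Fin n → Fin m → ℕ
  degTerm C x f = if does (f ∈? C) then endCount f x else 0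

  deg≡sum : ∀ C x → deg G C x ≡ sum (degTerm C x)
  deg≡sum C x = sum-map-allFin (degTerm C x)

  degTerm-∈ : ∀ {C x f} → f ∈ C → degTerm C x f ≡ endCount f x
  degTerm-∈ {C} {f = f} f∈ with f ∈? C
  ... | yes _ = refl
  ... | no f∉ = ⊥-elim (f∉ f∈)

  degTerm-∉ : ∀ {C x f} → f ∉ C → degTerm C x f ≡ 0
  degTerm-∉ {C} {f = f} f∉ with f ∈? C
  ... | yes f∈ = ⊥-elim (f∉ f∈)
  ... | no _ = refl

  endCount≡0⇒¬Incident : ∀ {f x} → endCount f x ≡ 0 → ¬ Incident G x f
  endCount≡0⇒¬Incident {f} {x} eq with end₁ G f ≟ x | end₂ G f ≟ x
  endCount≡0⇒¬Incident () | yes _ | _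
  endCount≡0⇒¬Incident () | no _  | yes _
  ... | no ¬p | no ¬q = [ ¬p , ¬q ]′

  ¬Incident⇒endCount≡0 : ∀ {f x} → ¬ Incident G x f → endCount f x ≡ 0
  ¬Incident⇒endCount≡0 {f} {x} ¬inc with end₁ G f ≟ x | end₂ G f ≟ x
  ... | yes p | _     = ⊥-elim (¬inc (inj₁ p))
  ... | no _  | yes q = ⊥-elim (¬inc (inj₂ q))
  ... | no _  | no _  = refl

  endCount≡1⇒ : ∀ {f x} → endCount f x ≡ 1 → Incident G x f × ¬ LoopAt G x f
  endCount≡1⇒ {f} {x} eq with end₁ G f ≟ x | end₂ G f ≟ x
  endCount≡1⇒ () | yes _ | yes _
  endCount≡1⇒ () | no _  | no _
  ... | yes p | no ¬q = inj₁ p , ¬q ∘ proj₂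
  ... | no ¬p | yes q = inj₂ q , ¬p ∘ proj₁

  deg≡0⇒¬Incident : ∀ {C x f} → deg G C x ≡ 0 → f ∈ C → ¬ Incident G x f
  deg≡0⇒¬Incident {C} {x} {f} eq f∈ = endCount≡0⇒¬Incident
    (trans (sym (degTerm-∈ f∈)) (sum≡0 (degTerm C x) (trans (sym (deg≡sum C x)) eq) f))

  ¬Incident⇒deg≡0 : ∀ {C x} → (∀ {f} → f ∈ C → ¬ Incident G x f) → deg G C x ≡ 0
  ¬Incident⇒deg≡0 {C} {x} ¬inc = trans (deg≡sum C x) (all≡0⇒sum≡0 _ term≡0)
    where
    term≡0 : ∀ f → degTerm C x f ≡ 0
    term≡0 f with f ∈? C
    ... | yes f∈ = ¬Incident⇒endCount≡0 (¬inc f∈)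
    ... | no _ = refl

  leafEdge : ∀ {C x} → deg G C x ≡ 1 →
             ∃[ f ] f ∈ C × Incident G x f × ¬ LoopAt G x f × (∀ {g} → g ∈ C → Incident G x g → g ≡ f)
  leafEdge {C} {x} eq with sum≡1 (degTerm C x) (trans (sym (deg≡sum C x)) eq)
  ... | f , f≡1 , rest with f ∈? C
  ... | no _ with () ← f≡1
  ... | yes f∈ = let f~ , ¬loop = endCount≡1⇒ f≡1 in f , f∈ , f~ , ¬loop , unique
    where
    unique : ∀ {g} → g ∈ C → Incident G x g → g ≡ f
    unique {g} g∈ g~ with g ≟ f
    ... | yes g≡f = g≡f
    ... | no g≢f = ⊥-elim (endCount≡0⇒¬Incident (trans (sym (degTerm-∈ g∈)) (rest g g≢f)) g~)

  deg-local : ∀ {C D x} → C ⊆ D → (∀ {f} → f ∈ D → Incident G x f → f ∈ C) → deg G C x ≡ deg G D x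
  deg-local {C} {D} {x} C⊆D D⊆C =
    trans (deg≡sum C x) (trans (sum-cong-≗ term≡) (sym (deg≡sum D x)))
    where
    term≡ : ∀ f → degTerm C x f ≡ degTerm D x f
    term≡ f with f ∈? C | f ∈? D
    ... | yes _   | yes _   = refl
    ... | yes f∈C | no f∉D  = ⊥-elim (f∉D (C⊆D f∈C))
    ... | no f∉C  | yes f∈D = sym (¬Incident⇒endCount≡0 (f∉C ∘ D⊆C f∈D))
    ... | no _    | no _    = refl

  deg-split : ∀ {C D} x → C ⊆ D → deg G D x ≡ deg G C x + deg G (D ─ C) x
  deg-split {C} {D} x C⊆D = begin
    deg G D x                                              ≡⟨ deg≡sum D x ⟩
    sum (degTerm D x)                                      ≡⟨ sum-cong-≗ term≡ ⟩
    sum (λ f → degTerm C x f + degTerm (D ─ C) x f)        ≡⟨ ∑-distrib-+ (degTerm C x) _ ⟩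
    sum (degTerm C x) + sum (degTerm (D ─ C) x)            ≡⟨ cong₂ _+_ (deg≡sum C x) (deg≡sum (D ─ C) x) ⟨
    deg G C x + deg G (D ─ C) x                            ∎
    where
    open ≡-Reasoning
    term≡ : ∀ f → degTerm D x f ≡ degTerm C x f + degTerm (D ─ C) x f
    term≡ f with f ∈? C
    ... | yes f∈C = trans (degTerm-∈ (C⊆D f∈C)) (trans (sym (+-identityʳ _))
                      (cong (endCount f x +_) (sym (degTerm-∉ λ f∈ → x∈p─q⇒x∉q D C f∈ f∈C))))
    ... | no f∉C with f ∈? D
    ...   | yes f∈D = sym (degTerm-∈ (x∈p∧x∉q⇒x∈p─q f∈D f∉C))
    ...   | no f∉D = sym (degTerm-∉ (f∉D ∘ p─q⊆p D C))

  -- Double counting of ends; a loop contributes both of its ends to the same degree.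
  handshake : ∀ F → sum (deg G F) ≡ ∣ F ∣ + ∣ F ∣
  handshake F = begin
    sum (deg G F)                               ≡⟨ sum-cong-≗ (deg≡sum F) ⟩
    sum (λ x → sum (λ f → degTerm F x f))       ≡⟨ ∑-comm (λ x f → degTerm F x f) ⟩
    sum (λ f → sum (λ x → degTerm F x f))       ≡⟨ sum-cong-≗ edgeSum ⟩
    sum (λ f → χ F f + χ F f)                   ≡⟨ ∑-distrib-+ (χ F) (χ F) ⟩
    sum (χ F) + sum (χ F)                       ≡⟨ cong₂ _+_ (∣p∣≡sum-χ F) (∣p∣≡sum-χ F) ⟨
    ∣ F ∣ + ∣ F ∣                               ∎
    where
    open ≡-Reasoning
    edgeSum : ∀ f → sum (λ x → degTerm F x f) ≡ χ F f + χ F f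
    edgeSum f with f ∈? F
    ... | yes _ = trans (∑-distrib-+ (λ x → b2n G (does (end₁ G f ≟ x))) _)
                    (cong₂ _+_ (sum-δ G (end₁ G f)) (sum-δ G (end₂ G f)))
    ... | no _ = all≡0⇒sum≡0 {n} (λ _ → 0) λ _ → refl

  deg≢0? : ∀ F x → Dec (deg G F x ≢ 0)
  deg≢0? F x = ¬? (deg G F x ℕ.≟ 0)

  -- The vertex set of the subgraph G[F]. Taken through degrees, it fits the counting with
  -- `handshake`.
  vertices : Subset m → Subset n
  vertices F = filterFin (deg≢0? F)

  ∈vertices⁺ : ∀ {F f x} → f ∈ F → Incident G x f → x ∈ vertices F
  ∈vertices⁺ f∈ x~f = ∈-filterFin⁺ (deg≢0? _) λ eq → deg≡0⇒¬Incident eq f∈ x~f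

  ∈vertices⁻ : ∀ {F x} → x ∈ vertices F → ∃[ f ] f ∈ F × Incident G x f
  ∈vertices⁻ {F} {x} x∈ with any? (λ f → f ∈? F ×-dec Incident? x f)
  ... | yes w = w
  ... | no ¬w = ⊥-elim (∈-filterFin⁻ (deg≢0? F) x∈
                  (¬Incident⇒deg≡0 λ f∈ x~f → ¬w (_ , f∈ , x~f)))

  -- Leafless edge sets, forests and cycles.

  Leafless : Subset m → Set
  Leafless F = ∀ x → deg G F x ≢ 1

  Leafless? : ∀ F → Dec (Leafless F)
  Leafless? F = all? λ x → ¬? (deg G F x ℕ.≟ 1)

  leaf : ∀ {F} → ¬ Leafless F → ∃[ x ] deg G F x ≡ 1
  leaf {F} ¬leafless with any? (λ x → deg G F x ℕ.≟ 1)
  ... | yes w = w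
  ... | no ¬w = ⊥-elim (¬leafless λ x eq → ¬w (x , eq))

  χ+χ≤deg : ∀ {F} → Leafless F → ∀ x → χ (vertices F) x + χ (vertices F) x ≤ deg G F x
  χ+χ≤deg {F} leafless x with x ∈? vertices F
  ... | no _ = z≤n
  ... | yes x∈ = 2≤ (∈-filterFin⁻ (deg≢0? F) x∈) (leafless x)
    where
    2≤ : ∀ {d} → d ≢ 0 → d ≢ 1 → 2 ≤ d
    2≤ {zero} ≢0 _ = ⊥-elim (≢0 refl)
    2≤ {suc zero} _ ≢1 = ⊥-elim (≢1 refl)
    2≤ {suc (suc d)} _ _ = s≤s (s≤s z≤n)

  sum-χ+χ : ∀ {k} (S : Subset k) → sum (λ x → χ S x + χ S x) ≡ ∣ S ∣ + ∣ S ∣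
  sum-χ+χ S = trans (∑-distrib-+ (χ S) (χ S)) (sym (cong₂ _+_ (∣p∣≡sum-χ S) (∣p∣≡sum-χ S)))

  -- Each vertex of G[F] has degree at least two, so twice the number of vertices is at most the
  -- degree sum.
  ∣vertices∣≤ : ∀ {F} → Leafless F → ∣ vertices F ∣ ≤ ∣ F ∣
  ∣vertices∣≤ {F} leafless = halve (begin
    ∣ vertices F ∣ + ∣ vertices F ∣                     ≡⟨ sum-χ+χ (vertices F) ⟨
    sum (λ x → χ (vertices F) x + χ (vertices F) x)     ≤⟨ sum-mono-≤ (χ+χ≤deg leafless) ⟩
    sum (deg G F)                                       ≡⟨ handshake F ⟩
    ∣ F ∣ + ∣ F ∣                                       ∎)
    where
    open ≤-Reasoning
    halve : ∀ {a b} → a + a ≤ b + b → a ≤ b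
    halve {a} {b} le with a ≤? b
    ... | yes a≤b = a≤b
    ... | no a≰b = ⊥-elim (<⇒≱ (+-mono-< (≰⇒> a≰b) (≰⇒> a≰b)) le)

  -- Acyclicity, phrased through leaves so that leaf deletion can be used before any cycle has been
  -- constructed.
  Forest : Subset m → Set
  Forest F = ∀ D → D ⊆ F → Nonempty D → ¬ Leafless D

  -- A leaf is deleted from `W` along with its edge. The other end of that edge differs from the
  -- leaf, so `W` stays nonempty.
  forest-card : ∀ {F W} → Forest F → (∀ {f x} → f ∈ F → Incident G x f → x ∈ W) → Nonempty W → ∣ F ∣ < ∣ W ∣
  forest-card {F₀} forest₀ spans₀ ne₀ = go _ F₀ _ ≤-refl forest₀ spans₀ ne₀
    where
    go : ∀ k F W → ∣ F ∣ ≤ k → Forest F → (∀ {f x} → f ∈ F → Incident G x f → x ∈ W) → Nonempty W → ∣ F ∣ < ∣ W ∣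
    go k F W ∣F∣≤ forest spans (w , w∈) with nonempty? F
    go k F W ∣F∣≤ forest spans (w , w∈) | no ¬ne = subst (_< ∣ W ∣) (sym (Empty⇒∣∣≡0 ¬ne)) (x∈p⇒0<∣p∣ w∈)
    go zero F W ∣F∣≤ forest spans _ | yes (f , f∈) with () ← ≤-trans (x∈p⇒0<∣p∣ f∈) ∣F∣≤
    go (suc k) F W ∣F∣≤ forest spans _ | yes ne with leaf (forest F id ne)
    ... | x , deg≡1 with leafEdge {F} {x} deg≡1
    ... | f , f∈ , x~f , ¬loop , unique with otherEnd x~f
    ... | y , y~f , x≡y⇒loop =
      subst₂ _<_ (sym (∣p-x∣ f∈)) (sym (∣p-x∣ (spans f∈ x~f)))
        (s≤s (go k (F - f) (W - x) (≤-pred (subst (_≤ suc k) (∣p-x∣ f∈) ∣F∣≤))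
          (λ D D⊆ → forest D (p-x⊆p F f ∘ D⊆))
          (λ {g} {z} g∈ z~g → x∈p∧x≢y⇒x∈p-y (spans (p-x⊆p F f g∈) z~g)
             λ { refl → x∈p-y⇒x≢y F g∈ (unique (p-x⊆p F f g∈) z~g) })
          (y , x∈p∧x≢y⇒x∈p-y (spans f∈ y~f) (¬loop ∘ x≡y⇒loop ∘ sym))))

  -- By `forest-card`, `F` has at most as many edges as vertices. Since nonzero degrees are at least
  -- two, equality is forced in the count of ends, vertex by vertex.
  unicyclic⇒2-regular : ∀ {F f} → f ∈ F → Leafless F → Forest (F - f) → ∀ x → (deg G F x ≡ 0) ⊎ (deg G F x ≡ 2)
  unicyclic⇒2-regular {F} {f} f∈ leafless forest x with x ∈? vertices F | tight x
    where
    ∣F∣≤ : ∣ F ∣ ≤ ∣ vertices F ∣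
    ∣F∣≤ = subst (_≤ ∣ vertices F ∣) (sym (∣p-x∣ f∈))
      (forest-card forest (λ g∈ → ∈vertices⁺ (p-x⊆p F f g∈)) (_ , ∈vertices⁺ f∈ (inj₁ refl)))

    tight : ∀ x → χ (vertices F) x + χ (vertices F) x ≡ deg G F x
    tight = sum-tight (χ+χ≤deg leafless) (begin
      sum (deg G F)                                       ≡⟨ handshake F ⟩
      ∣ F ∣ + ∣ F ∣                                       ≤⟨ +-mono-≤ ∣F∣≤ ∣F∣≤ ⟩
      ∣ vertices F ∣ + ∣ vertices F ∣                     ≡⟨ sum-χ+χ (vertices F) ⟨
      sum (λ x → χ (vertices F) x + χ (vertices F) x)     ∎)
      where open ≤-Reasoning
  ... | yes _ | eq = inj₂ (sym eq)
  ... | no _  | eq = inj₁ (sym eq)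

  Cycle⇒Leafless : ∀ {C} → Cycle G C → Leafless C
  Cycle⇒Leafless (_ , _ , reg) x eq with reg x
  ... | inj₁ eq′ with () ← trans (sym eq) eq′
  ... | inj₂ eq′ with () ← trans (sym eq) eq′

  -- A vertex of `D` already has degree two in `D`, so all edges of `C` at it are in `D`.
  -- Connectedness of `C` spreads this to every edge.
  Cycle-minimal : ∀ {C D} → Cycle G C → D ⊆ C → Nonempty D → Leafless D → C ⊆ D
  Cycle-minimal {C} {D} (_ , conn , reg) D⊆C (d , d∈) leafless {g} g∈ =
    absorb (Conn-invariant (_∈ vertices D) (∈vertices⁺ d∈ (inj₁ refl))
             (λ _ f∈ x~f y~f x∈ → ∈vertices⁺ (absorb x∈ f∈ x~f) y~f) (conn d g (D⊆C d∈) g∈))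
           g∈ (inj₁ refl)
    where
    rest≡0 : ∀ {a b c} → c ≡ a + b → a ≢ 0 → a ≢ 1 → (c ≡ 0) ⊎ (c ≡ 2) → b ≡ 0
    rest≡0 {zero} _ ≢0 _ _ = ⊥-elim (≢0 refl)
    rest≡0 {suc zero} _ _ ≢1 _ = ⊥-elim (≢1 refl)
    rest≡0 {suc (suc a)} refl _ _ (inj₁ ())
    rest≡0 {suc (suc zero)} refl _ _ (inj₂ refl) = refl

    absorb : ∀ {x f} → x ∈ vertices D → f ∈ C → Incident G x f → f ∈ D
    absorb {x} {f} x∈ f∈ x~f with f ∈? D
    ... | yes f∈D = f∈D
    ... | no f∉D = ⊥-elim (deg≡0⇒¬Incident
      (rest≡0 (deg-split x D⊆C) (∈-filterFin⁻ (deg≢0? D) x∈) (leafless x) (reg x))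
      (x∈p∧x∉q⇒x∈p─q f∈ f∉D) x~f)

  private
    -- Deleting one edge leaves a forest by minimality, which gives regularity. For connectedness,
    -- the edges of `F` in one component form a leafless subset, hence all of `F`.
    minimal⇒Cycle : ∀ {F} → Nonempty F → Leafless F →
                    (∀ D → D ⊂ F → Nonempty D → ¬ Leafless D) → Cycle G F
    minimal⇒Cycle {F} ne@(f₀ , f₀∈) leafless minimal = ne , connected ,
      unicyclic⇒2-regular f₀∈ leafless
        (λ D D⊆ → minimal D (p-x⊆p F f₀ ∘ D⊆ , f₀ , f₀∈ , x∉p-x f₀ F ∘ D⊆))
      where
      connected : ∀ f g → f ∈ F → g ∈ F → Conn G F (end₁ G f) (end₁ G g)
      connected f g f∈ g∈ with class F (end₁ G f)
      ... | K , K-class = Class⇒Conn K-class (proj₂ (inPart (all-in g∈)))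
        where
        InPart? : ∀ h → Dec (h ∈ F × end₁ G h ∈ K)
        InPart? h = h ∈? F ×-dec end₁ G h ∈? K

        part : Subset m
        part = filterFin InPart?

        inPart : ∀ {h} → h ∈ part → h ∈ F × end₁ G h ∈ K
        inPart = ∈-filterFin⁻ InPart?

        part-leafless : Leafless part
        part-leafless x eq with x ∈? K
        ... | yes x∈ = leafless x (trans (sym (deg-local (proj₁ ∘ inPart)
                λ h∈ x~h → ∈-filterFin⁺ InPart? (h∈ , Class-closed K-class h∈ x~h (inj₁ refl) x∈))) eq)
        ... | no x∉ with () ← trans (sym eq) (¬Incident⇒deg≡0 λ h∈ x~h →
                x∉ (Class-closed K-class (proj₁ (inPart h∈)) (inj₁ refl) x~h (proj₂ (inPart h∈))))

        all-in : F ⊆ part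
        all-in with F ⊆? part
        ... | yes F⊆ = F⊆
        ... | no F⊈ = ⊥-elim (minimal part (⊆∧⊉⇒⊂ (proj₁ ∘ inPart) F⊈)
                (f , ∈-filterFin⁺ InPart? (f∈ , Conn⇒Class K-class here)) part-leafless)

  Leafless⇒∃Cycle : ∀ {F} → Nonempty F → Leafless F → ∃[ C ] C ⊆ F × Cycle G C
  Leafless⇒∃Cycle {F₀} = go _ F₀ ≤-refl
    where
    go : ∀ k F → ∣ F ∣ ≤ k → Nonempty F → Leafless F → ∃[ C ] C ⊆ F × Cycle G C
    go k F ∣F∣≤ ne leafless with anySubset? (λ D → D ⊂? F ×-dec nonempty? D ×-dec Leafless? D)
    go k F ∣F∣≤ ne leafless | no ¬smaller = F , id ,
      minimal⇒Cycle ne leafless λ D D⊂ ne′ leafless′ → ¬smaller (D , D⊂ , ne′ , leafless′)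
    go zero F ∣F∣≤ (f , f∈) leafless | yes _ with () ← ≤-trans (x∈p⇒0<∣p∣ f∈) ∣F∣≤
    go (suc k) F ∣F∣≤ ne leafless | yes (D , D⊂ , ne′ , leafless′) =
      let C , C⊆ , cyc = go k D (≤-pred (≤-trans (p⊂q⇒∣p∣<∣q∣ D⊂) ∣F∣≤)) ne′ leafless′
      in C , proj₁ D⊂ ∘ C⊆ , cyc

  -- Deleting an edge `f` of the cycle `C` leaves a forest, since any cycle left would be a second
  -- one. So all degrees of `F` are 0 or 2, and likewise those of `F ─ C`; if nonempty, the latter
  -- would contain a second cycle.
  Leafless∧unique⇒Cycle : ∀ {F} → Nonempty F → Leafless F →
    (∀ C D → C ⊆ F → D ⊆ F → Cycle G C → Cycle G D → C ≡ D) → Cycle G F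
  Leafless∧unique⇒Cycle {F} ne leafless unique with Leafless⇒∃Cycle ne leafless
  ... | C , C⊆F , cyc@((f , f∈C) , _ , reg) = subst (Cycle G) (⊆-antisym C⊆F F⊆C) cyc
    where
    forest : Forest (F - f)
    forest D D⊆ ne′ leafless′ =
      let C′ , C′⊆ , cyc′ = Leafless⇒∃Cycle ne′ leafless′
          C≡C′ = unique C C′ C⊆F (p-x⊆p F f ∘ D⊆ ∘ C′⊆) cyc cyc′
      in x∉p-x f F (D⊆ (C′⊆ (subst (f ∈_) C≡C′ f∈C)))

    parity : ∀ {a b c} → c ≡ a + b → (c ≡ 0) ⊎ (c ≡ 2) → (a ≡ 0) ⊎ (a ≡ 2) → b ≢ 1
    parity () (inj₁ refl) (inj₁ refl) refl
    parity () (inj₁ refl) (inj₂ refl) refl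
    parity () (inj₂ refl) (inj₁ refl) refl
    parity () (inj₂ refl) (inj₂ refl) refl

    F⊆C : F ⊆ C
    F⊆C {g} g∈ with g ∈? C
    ... | yes g∈C = g∈C
    ... | no g∉C =
      let C′ , C′⊆ , cyc′ = Leafless⇒∃Cycle {F ─ C} (g , x∈p∧x∉q⇒x∈p─q g∈ g∉C)
            (λ x → parity (deg-split x C⊆F) (unicyclic⇒2-regular (C⊆F f∈C) leafless forest x) (reg x))
          C≡C′ = unique C C′ C⊆F (p─q⊆p F C ∘ C′⊆) cyc cyc′
      in ⊥-elim (x∈p─q⇒x∉q F C (C′⊆ (subst (f ∈_) C≡C′ f∈C)) f∈C)

  LoopAt⇒Cycle : ∀ {v e} → LoopAt G v e → Cycle G ⁅ e ⁆
  LoopAt⇒Cycle {v} {e} (p , q) = (e , x∈⁅x⁆ e) ,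
    (λ f g f∈ g∈ → subst₂ (λ a b → Conn G ⁅ e ⁆ (end₁ G a) (end₁ G b)) (sym (x∈⁅y⁆⇒x≡y e f∈)) (sym (x∈⁅y⁆⇒x≡y e g∈)) here) ,
    regular
    where
    leafless : Leafless ⁅ e ⁆
    leafless x eq with leafEdge {⁅ e ⁆} {x} eq
    ... | f , f∈ , x~f , ¬loop , _ with x∈⁅y⁆⇒x≡y e f∈
    ... | refl = ¬loop ([ (λ { refl → refl , trans q (sym p) }) , (λ { refl → trans p (sym q) , refl }) ]′ x~f)

    regular : ∀ x → (deg G ⁅ e ⁆ x ≡ 0) ⊎ (deg G ⁅ e ⁆ x ≡ 2)
    regular = unicyclic⇒2-regular (x∈⁅x⁆ e) leafless
      λ D D⊆ (f , f∈) _ → x∈p-y⇒x≢y ⁅ e ⁆ (D⊆ f∈) (x∈⁅y⁆⇒x≡y e (p-x⊆p ⁅ e ⁆ e (D⊆ f∈)))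

-- Rank bounds from the framework axioms.

module FrameworkProperties {n m : ℕ} (G : Graph n m) (M : Matroid m) (fw : Framework G M) where
  open Matroid M
  open MatroidProperties M
  open GraphProperties G
  open Framework fw
  open ≤-Reasoning

  LoopAt-unique : ∀ {v e x} → LoopAt G v e → Incident G x e → x ≡ v
  LoopAt-unique (p , q) (inj₁ p′) = trans (sym p′) p
  LoopAt-unique (p , q) (inj₂ q′) = trans (sym q′) q

  loop∈EdgesMinus : ∀ {v e x} → LoopAt G v e → x ≢ v → e ∈ EdgesMinus G x
  loop∈EdgesMinus loop x≢v = ∈EdgesMinus⁺ (x≢v ∘ LoopAt-unique loop)

  ends-exhaust : ∀ {f x y z} → x ≢ y → Incident G x f → Incident G y f → Incident G z f → z ≡ x ⊎ z ≡ y
  ends-exhaust x≢y (inj₁ p) (inj₁ q) _        = ⊥-elim (x≢y (trans (sym p) q))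
  ends-exhaust x≢y (inj₁ p) (inj₂ q) (inj₁ s) = inj₁ (trans (sym s) p)
  ends-exhaust x≢y (inj₁ p) (inj₂ q) (inj₂ s) = inj₂ (trans (sym s) q)
  ends-exhaust x≢y (inj₂ p) (inj₁ q) (inj₁ s) = inj₂ (trans (sym s) q)
  ends-exhaust x≢y (inj₂ p) (inj₁ q) (inj₂ s) = inj₁ (trans (sym s) p)
  ends-exhaust x≢y (inj₂ p) (inj₂ q) _        = ⊥-elim (x≢y (trans (sym p) q))

  Within? : ∀ S f → Dec (end₁ G f ∈ S × end₂ G f ∈ S)
  Within? S f = end₁ G f ∈? S ×-dec end₂ G f ∈? S

  within : Subset n → Subset m
  within S = filterFin (Within? S)

  ∈within⁺ : ∀ {S f} → (∀ {x} → Incident G x f → x ∈ S) → f ∈ within S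
  ∈within⁺ {S} ends∈ = ∈-filterFin⁺ (Within? S) (ends∈ (inj₁ refl) , ends∈ (inj₂ refl))

  ∈within⁻ : ∀ {S f x} → f ∈ within S → Incident G x f → x ∈ S
  ∈within⁻ {S} f∈ (inj₁ refl) = proj₁ (∈-filterFin⁻ (Within? S) f∈)
  ∈within⁻ {S} f∈ (inj₂ refl) = proj₂ (∈-filterFin⁻ (Within? S) f∈)

  within-mono : ∀ {S T} → S ⊆ T → within S ⊆ within T
  within-mono S⊆T f∈ = ∈within⁺ λ x~f → S⊆T (∈within⁻ f∈ x~f)

  Meets? : ∀ S f → Dec (end₁ G f ∈ S ⊎ end₂ G f ∈ S)
  Meets? S f = end₁ G f ∈? S ⊎-dec end₂ G f ∈? S

  meeting : Subset n → Subset m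
  meeting S = filterFin (Meets? S)

  ∈meeting⁺ : ∀ {S f x} → Incident G x f → x ∈ S → f ∈ meeting S
  ∈meeting⁺ {S} (inj₁ refl) x∈ = ∈-filterFin⁺ (Meets? S) (inj₁ x∈)
  ∈meeting⁺ {S} (inj₂ refl) x∈ = ∈-filterFin⁺ (Meets? S) (inj₂ x∈)

  ∈meeting⁻ : ∀ {S f} → f ∈ meeting S → ∃[ x ] Incident G x f × x ∈ S
  ∈meeting⁻ {S} f∈ = [ (λ x∈ → _ , inj₁ refl , x∈) , (λ x∈ → _ , inj₂ refl , x∈) ]′ (∈-filterFin⁻ (Meets? S) f∈)

  -- Contrapositive of axiom (3), for any set of edges avoiding `x`.
  nonloop∉cl : ∀ {x f Y} → Incident G x f → ¬ LoopAt G x f → Y ⊆ EdgesMinus G x → ¬ InCl M Y f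
  nonloop∉cl x~f ¬loop Y⊆ f∈cl =
    [ (λ f∈ → ∈EdgesMinus⁻ f∈ x~f) , ¬loop ]′ (closure _ _ (InCl-mono Y⊆ f∈cl))

  Class-rebase : ∀ {X s t K} → Class X s K → t ∈ K → Class X t K
  Class-rebase K-class t∈ w = mk⇔
    (λ w∈ → Conn-trans (Conn-sym (Class⇒Conn K-class t∈)) (Class⇒Conn K-class w∈))
    (λ p → Conn⇒Class K-class (Conn-trans (Class⇒Conn K-class t∈) p))

  Class-disjoint : ∀ {X s t K L} → Class X s K → Class X t L → t ∉ K → ∀ {x} → x ∈ K → x ∉ L
  Class-disjoint K-class L-class t∉K x∈K x∈L =
    t∉K (Conn⇒Class K-class (Conn-trans (Class⇒Conn K-class x∈K) (Conn-sym (Class⇒Conn L-class x∈L))))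

  -- Each vertex added to S comes with a nonloop edge outside the closure of all edges avoiding that vertex.
  rank-growth : ∀ {X s K S Y} → Class X s K → s ∈ S → S ⊆ K → (∀ {x} → x ∈ K → x ∉ S → Y ⊆ EdgesMinus G x) →
                r (within S ∪ Y) + ∣ K ∣ ≤ r (within K ∪ Y) + ∣ S ∣
  rank-growth {X} {s} {K} {S₀} {Y} K-class s∈ S⊆ avoid = go ∣ K ∣ S₀ (m≤n+m _ _) s∈ S⊆ avoid
    where
    go : ∀ k S → ∣ K ∣ ≤ ∣ S ∣ + k → s ∈ S → S ⊆ K → (∀ {x} → x ∈ K → x ∉ S → Y ⊆ EdgesMinus G x) →
         r (within S ∪ Y) + ∣ K ∣ ≤ r (within K ∪ Y) + ∣ S ∣
    go k S ∣K∣≤ s∈ S⊆K avoid with K ⊆? S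
    ... | yes K⊆S = subst (λ T → r (within S ∪ Y) + ∣ T ∣ ≤ r (within T ∪ Y) + ∣ S ∣) (⊆-antisym S⊆K K⊆S) ≤-refl
    go zero S ∣K∣≤ s∈ S⊆K avoid | no K⊈S =
      ⊥-elim (<⇒≱ (p⊂q⇒∣p∣<∣q∣ (⊆∧⊉⇒⊂ S⊆K K⊈S)) (subst (∣ K ∣ ≤_) (+-identityʳ _) ∣K∣≤))
    go (suc k) S ∣K∣≤ s∈ S⊆K avoid | no K⊈S with ⊈⇒∃∈∖ K S K⊈S
    ... | x , x∈K , x∉S with crossing s∈ x∉S (Class⇒Conn K-class x∈K)
    ... | f , y , (f∈X , y~f , y∉S , z , z~f , z∈S) , s⇝y = +-cancelˡ-≤ 1 _ _ (begin
      suc (r (within S ∪ Y)) + ∣ K ∣            ≤⟨ +-monoˡ-≤ ∣ K ∣ gain ⟩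
      r (within (S ∪ ⁅ y ⁆) ∪ Y) + ∣ K ∣        ≤⟨ go k (S ∪ ⁅ y ⁆) ∣K∣≤′ (p⊆p∪q ⁅ y ⁆ s∈) (∪-least S ⁅ y ⁆ S⊆K (⁅⁆-⊆ y∈K))
                                                     (λ w∈ w∉ → avoid w∈ (w∉ ∘ p⊆p∪q ⁅ y ⁆)) ⟩
      r (within K ∪ Y) + ∣ S ∪ ⁅ y ⁆ ∣          ≡⟨ cong (r (within K ∪ Y) +_) (∣p∪x∣ y∉S) ⟩
      r (within K ∪ Y) + suc ∣ S ∣              ≡⟨ +-suc _ ∣ S ∣ ⟩
      suc (r (within K ∪ Y) + ∣ S ∣)            ∎)
      where
      y∈K : y ∈ K
      y∈K = Conn⇒Class K-class s⇝y

      ∣K∣≤′ : ∣ K ∣ ≤ ∣ S ∪ ⁅ y ⁆ ∣ + k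
      ∣K∣≤′ = subst (∣ K ∣ ≤_) (trans (+-suc _ k) (cong (_+ k) (sym (∣p∪x∣ y∉S)))) ∣K∣≤

      y≢z : y ≢ z
      y≢z refl = y∉S z∈S

      f∉cl : ¬ InCl M (within S ∪ Y) f
      f∉cl = nonloop∉cl y~f (λ loop → y≢z (sym (LoopAt-unique loop z~f)))
        (∪-least (within S) Y (λ g∈ → ∈EdgesMinus⁺ λ y~g → y∉S (∈within⁻ g∈ y~g)) (avoid y∈K y∉S))

      f∈within : f ∈ within (S ∪ ⁅ y ⁆)
      f∈within = ∈within⁺ λ w~f → [ (λ { refl → q⊆p∪q S ⁅ y ⁆ (x∈⁅x⁆ y) }) , (λ { refl → p⊆p∪q ⁅ y ⁆ z∈S }) ]′
        (ends-exhaust y≢z y~f z~f w~f)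

      gain : suc (r (within S ∪ Y)) ≤ r (within (S ∪ ⁅ y ⁆) ∪ Y)
      gain = ≤-trans (¬InCl⇒r-< f∉cl) (r-mono _ _
        (∪-least (within S ∪ Y) ⁅ f ⁆ (∪-monoˡ-⊆ (within S) _ Y (within-mono (p⊆p∪q ⁅ y ⁆)))
                                      (⁅⁆-⊆ (p⊆p∪q Y f∈within))))

  -- Axiom (2) bounds the rank of the whole component of `s`, and `rank-growth` carries the bound
  -- down to `S`.
  connected-rank : ∀ {s S} → s ∈ S → (∀ {x} → x ∈ S → Conn G ⊤ s x) → r (within S) ≤ ∣ S ∣
  connected-rank {s} {S} s∈ conn with class ⊤ s
  ... | K , K-class = +-cancelʳ-≤ ∣ K ∣ _ _ (begin
    r (within S) + ∣ K ∣        ≤⟨ +-monoˡ-≤ ∣ K ∣ (r-mono _ _ (p⊆p∪q ⊥)) ⟩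
    r (within S ∪ ⊥) + ∣ K ∣    ≤⟨ rank-growth K-class s∈ (Conn⇒Class K-class ∘ conn) (λ _ _ → ⊥-elim ∘ ∉⊥) ⟩
    r (within K ∪ ⊥) + ∣ S ∣    ≤⟨ +-monoˡ-≤ ∣ S ∣ (r-mono _ _ (∪-least (within K) ⊥ id (⊥-elim ∘ ∉⊥))) ⟩
    r (within K) + ∣ S ∣        ≤⟨ +-monoˡ-≤ ∣ S ∣ (comp-rank K (within K) (s , K-class) within⇔) ⟩
    ∣ K ∣ + ∣ S ∣               ≡⟨ +-comm ∣ K ∣ _ ⟩
    ∣ S ∣ + ∣ K ∣               ∎)
    where
    -- No edge leaves a component, so testing a single end selects exactly the edges within `K`.
    within⇔ : ∀ f → (f ∈ within K) ⇔ (end₁ G f ∈ K)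
    within⇔ f = mk⇔ (λ f∈ → ∈within⁻ f∈ (inj₁ refl))
      λ x∈ → ∈within⁺ λ y~f → Class-closed K-class ∈⊤ (inj₁ refl) y~f x∈

  class-rank : ∀ {X s K} → Class X s K → r (within K) ≤ ∣ K ∣
  class-rank K-class = connected-rank (Conn⇒Class K-class here) λ x∈ → Conn-mono ⊆⊤ (Class⇒Conn K-class x∈)

  avoids : ∀ {v w K} → w ≢ v → Class (EdgesMinus G v) w K → v ∉ K
  avoids {v} w≢v K-class v∈ = Conn-invariant (_≢ v) w≢v
    (λ { _ f∈ _ y~f _ refl → ∈EdgesMinus⁻ f∈ y~f }) (Class⇒Conn K-class v∈) refl

  -- One component of G - v, with vertex set `side`, whose edges span `e`. Under `EdgesMinus G v`
  -- the vertex `v` has the class `⁅ v ⁆`, which `root≢v` rules out.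
  record Anchor (e : Fin m) (v : Fin n) : Set where
    field
      root      : Fin n
      root≢v    : root ≢ v
      side      : Subset n
      sideClass : Class (EdgesMinus G v) root side
      spanned   : InCl M (within side) e

    v∉side : v ∉ side
    v∉side = avoids root≢v sideClass

    root∈side : root ∈ side
    root∈side = Conn⇒Class sideClass here

    anchor-edge : r ⁅ e ⁆ ≡ 1 → Nonempty (within side)
    anchor-edge re≡1 with nonempty? (within side)
    ... | yes ne = ne
    ... | no ¬ne with () ← (begin
      1                        ≡⟨ re≡1 ⟨
      r ⁅ e ⁆                  ≤⟨ r-mono _ _ (q⊆p∪q (within side) ⁅ e ⁆) ⟩
      r (within side ∪ ⁅ e ⁆)  ≡⟨ spanned ⟩
      r (within side)          ≡⟨ Empty⇒r≡0 ¬ne ⟩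
      0                        ∎)

    -- This is `rank-growth` inside G - v with `e` carried along: `e` avoids all vertices of `side`,
    -- and adding it to the edges of the whole side costs no rank.
    anchored-rank : LoopAt G v e → ∀ {s S} → s ∈ S → S ⊆ side → r (within S ∪ ⁅ e ⁆) ≤ ∣ S ∣
    anchored-rank loop {s} {S} s∈ S⊆ = +-cancelʳ-≤ ∣ side ∣ _ _ (begin
      r (within S ∪ ⁅ e ⁆) + ∣ side ∣      ≤⟨ rank-growth (Class-rebase sideClass (S⊆ s∈)) s∈ S⊆
                                               (λ x∈ _ → ⁅⁆-⊆ (loop∈EdgesMinus loop λ { refl → v∉side x∈ })) ⟩
      r (within side ∪ ⁅ e ⁆) + ∣ S ∣      ≡⟨ cong (_+ ∣ S ∣) spanned ⟩
      r (within side) + ∣ S ∣              ≤⟨ +-monoˡ-≤ ∣ S ∣ (class-rank sideClass) ⟩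
      ∣ side ∣ + ∣ S ∣                     ≡⟨ +-comm ∣ side ∣ _ ⟩
      ∣ S ∣ + ∣ side ∣                     ∎)

  -- A circuit through e in E(G - v) ∪ {e} has e as one of its at most two components.
  anchor : ∀ {e v} → LoopAt G v e → r ⁅ e ⁆ ≡ 1 → InCl M (EdgesMinus G v) e → Anchor e v
  anchor {e} {v} loop re≡1 e∈cl
    with circuit-through re≡1 (λ e∈ → ∈EdgesMinus⁻ e∈ (inj₁ (proj₁ loop))) e∈cl
  ... | Y , Y⊆ , dependent , minimal with circuit-comps (Y ∪ ⁅ e ⁆) (dependent , minimal)
  ... | a , b , reach =
    -- `Y` avoids `v`, so the representative that reaches `v` reaches no end of an edge of `Y`. The
    -- other one reaches them all and becomes the root.
    [ (λ a⇝v → build b λ f∈ x~f → [ (λ a⇝x → ⊥-elim (apart f∈ x~f (Conn-trans (Conn-sym a⇝v) a⇝x))) , id ]′ (reach _ _ (p⊆p∪q ⁅ e ⁆ f∈) x~f))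
    , (λ b⇝v → build a λ f∈ x~f → [ id , (λ b⇝x → ⊥-elim (apart f∈ x~f (Conn-trans (Conn-sym b⇝v) b⇝x))) ]′ (reach _ _ (p⊆p∪q ⁅ e ⁆ f∈) x~f))
    ]′ (reach e v (q⊆p∪q Y ⁅ e ⁆ (x∈⁅x⁆ e)) (inj₁ (proj₁ loop)))
    where
    e∉Y : e ∉ Y
    e∉Y e∈ = ∈EdgesMinus⁻ (Y⊆ e∈) (inj₁ (proj₁ loop))

    spanY : InCl M Y e
    spanY with r (Y ∪ ⁅ e ⁆) ℕ.≟ r Y
    ... | yes e∈ = e∈
    ... | no e∉ = ⊥-elim (dependent (Independent-∪-⁅⁆
      (minimal Y (p⊆p∪q ⁅ e ⁆ , e , q⊆p∪q Y ⁅ e ⁆ (x∈⁅x⁆ e) , e∉Y)) e∉Y e∉))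

    edge : Nonempty Y
    edge with nonempty? Y
    ... | yes ne = ne
    ... | no ¬ne = ⊥-elim (dependent (≤-antisym (r-bound _) (begin
      ∣ Y ∪ ⁅ e ⁆ ∣  ≡⟨ ∣p∪x∣ e∉Y ⟩
      suc ∣ Y ∣      ≡⟨ cong suc (Empty⇒∣∣≡0 ¬ne) ⟩
      1              ≡⟨ re≡1 ⟨
      r ⁅ e ⁆        ≤⟨ r-mono _ _ (q⊆p∪q Y ⁅ e ⁆) ⟩
      r (Y ∪ ⁅ e ⁆)  ∎)))

    apart : ∀ {f x} → f ∈ Y → Incident G x f → ¬ Conn G (Y ∪ ⁅ e ⁆) v x
    apart f∈ x~f v⇝x = ∈EdgesMinus⁻ (Y⊆ f∈) (subst (λ z → Incident G z _)
      (Conn-invariant (_≡ v) refl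
        (λ { _ g∈ v~g y~g refl → [ (λ g∈Y → ⊥-elim (∈EdgesMinus⁻ (Y⊆ g∈Y) v~g))
                                 , (λ g∈e → LoopAt-unique (subst (LoopAt G v) (sym (x∈⁅y⁆⇒x≡y e g∈e)) loop) y~g) ]′
                                 (x∈p∪q⁻ Y ⁅ e ⁆ g∈) })
        v⇝x) x~f)

    build : ∀ c → (∀ {f x} → f ∈ Y → Incident G x f → Conn G (Y ∪ ⁅ e ⁆) c x) → Anchor e v
    build c from-c with class (EdgesMinus G v) c
    ... | K , K-class = record
      { root = c
      ; root≢v = λ { refl → apart (proj₂ edge) (inj₁ refl) (from-c (proj₂ edge) (inj₁ refl)) }
      ; side = K
      ; sideClass = K-class
      ; spanned = InCl-mono (λ f∈ → ∈within⁺ λ x~f → Conn⇒Class K-class (drop-loop (from-c f∈ x~f))) spanY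
      }
      where
      -- A step along `e` does not move, so it can be omitted from the walk.
      drop-loop : ∀ {x} → Conn G (Y ∪ ⁅ e ⁆) c x → Conn G (EdgesMinus G v) c x
      drop-loop = Conn-invariant (Conn G (EdgesMinus G v) c) here
        λ _ g∈ x~g y~g c⇝x → [ (λ g∈Y → Conn-trans c⇝x (Conn-edge (Y⊆ g∈Y) x~g y~g))
                             , (λ g∈e → subst (Conn G (EdgesMinus G v) c) (same g∈e x~g y~g) c⇝x) ]′
                             (x∈p∪q⁻ Y ⁅ e ⁆ g∈)
        where
        same : ∀ {g x y} → g ∈ ⁅ e ⁆ → Incident G x g → Incident G y g → x ≡ y
        same g∈e x~g y~g with x∈⁅y⁆⇒x≡y e g∈e
        ... | refl = trans (LoopAt-unique loop x~g) (sym (LoopAt-unique loop y~g))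

-- Consequences of 3-connectivity.

module ThreeConnectedFramework {n m : ℕ} (G : Graph n m) (M : Matroid m)
                               (fw : Framework G M) (tc : ThreeConnected M) where
  open Matroid M
  open MatroidProperties M
  open GraphProperties G
  open Framework fw
  open FrameworkProperties G M fw
  open ≤-Reasoning

  -- `A` has rank at most the size of `K`. Growing `⁅ s ⁆` to `K` in the presence of `∁ A` gains
  -- rank for every vertex but `s`, so the two ranks add up to at most `r ⊤ + 1`.
  no-separation : ∀ {X s K A} → Class X s K → A ⊆ within K →
                  (∀ {x} → x ∈ K → x ≢ s → ∁ A ⊆ EdgesMinus G x) → 2 ≤ ∣ A ∣ → ¬ (2 ≤ ∣ ∁ A ∣)
  no-separation {X} {s} {K} {A} K-class A⊆ avoid big big′ =
    tc 2 A (s≤s (s≤s (s≤s z≤n))) (big , big′ , (begin-strict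
      r A + r (∁ A)                             ≤⟨ +-mono-≤ (≤-trans (r-mono _ _ A⊆) (class-rank K-class))
                                                            (r-mono _ _ (q⊆p∪q (within ⁅ s ⁆) (∁ A))) ⟩
      ∣ K ∣ + r (within ⁅ s ⁆ ∪ ∁ A)            ≡⟨ +-comm ∣ K ∣ _ ⟩
      r (within ⁅ s ⁆ ∪ ∁ A) + ∣ K ∣            ≤⟨ rank-growth K-class (x∈⁅x⁆ s) (⁅⁆-⊆ (Conn⇒Class K-class here))
                                                     (λ x∈ x∉ → avoid x∈ λ { refl → x∉ (x∈⁅x⁆ s) }) ⟩
      r (within K ∪ ∁ A) + ∣ ⁅ s ⁆ ∣            ≤⟨ +-mono-≤ (r-mono _ _ ⊆⊤) (≤-reflexive (∣⁅x⁆∣≡1 s)) ⟩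
      r ⊤ + 1                                   <⟨ +-monoʳ-< (r ⊤) ≤-refl ⟩
      r ⊤ + 2                                   ∎))

  -- The edges meeting the component `K` of G - v share at most the vertex `v` with the remaining
  -- edges, so they would form one side of a 2-separation.
  side-no-separation : ∀ {v u K} → u ≢ v → Class (EdgesMinus G v) u K →
                       2 ≤ ∣ meeting K ∣ → ¬ (2 ≤ ∣ ∁ (meeting K) ∣)
  side-no-separation {v} {u} {K} u≢v K-class with any? (λ f → f ∈? meeting K ×-dec Incident? v f)
  ... | no ¬adj = no-separation K-class A⊆ λ x∈ _ → missed x∈
    where
    missed : ∀ {x} → x ∈ K → ∁ (meeting K) ⊆ EdgesMinus G x
    missed x∈ f∈ = ∈EdgesMinus⁺ λ x~f → x∈∁p⇒x∉p f∈ (∈meeting⁺ x~f x∈)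

    A⊆ : meeting K ⊆ within K
    A⊆ {f} f∈ = let x , x~f , x∈ = ∈meeting⁻ f∈ in
      ∈within⁺ λ y~f → Class-closed K-class (∈EdgesMinus⁺ λ v~f → ¬adj (f , f∈ , v~f)) x~f y~f x∈
  -- Now `v` is the single vertex of `K ∪ ⁅ v ⁆` that may meet other edges, so the growth starts
  -- there. Connectivity is taken in `meeting K`, which keeps the class from leaving `K ∪ ⁅ v ⁆`.
  ... | yes (f₀ , f₀∈ , v~f₀) = no-separation {X = meeting K} {s = v} {K = K ∪ ⁅ v ⁆} K∪v-class A⊆
      λ x∈ x≢v f∈ → ∈EdgesMinus⁺ λ x~f → x∈∁p⇒x∉p f∈ (∈meeting⁺ x~f (drop-v x∈ x≢v))
    where
    drop-v : ∀ {x} → x ∈ K ∪ ⁅ v ⁆ → x ≢ v → x ∈ K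
    drop-v x∈ x≢v = [ id , (λ x∈v → ⊥-elim (x≢v (x∈⁅y⁆⇒x≡y v x∈v))) ]′ (x∈p∪q⁻ K ⁅ v ⁆ x∈)

    far-end : ∀ {f y} → f ∈ meeting K → Incident G y f → y ∈ K ∪ ⁅ v ⁆
    far-end {f} {y} f∈ y~f with y ≟ v
    ... | yes refl = q⊆p∪q K ⁅ v ⁆ (x∈⁅x⁆ v)
    ... | no y≢v with ∈meeting⁻ f∈
    ...   | x , x~f , x∈ with x ≟ y
    ...     | yes refl = p⊆p∪q ⁅ v ⁆ x∈
    ...     | no x≢y = p⊆p∪q ⁅ v ⁆ (Class-closed K-class (∈EdgesMinus⁺ λ v~f →
                [ (λ { refl → avoids u≢v K-class x∈ }) , y≢v ∘ sym ]′ (ends-exhaust x≢y x~f y~f v~f)) x~f y~f x∈)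

    A⊆ : meeting K ⊆ within (K ∪ ⁅ v ⁆)
    A⊆ f∈ = ∈within⁺ (far-end f∈)

    u⇝ : ∀ {x} → Conn G (EdgesMinus G v) u x → Conn G (meeting K) u x
    u⇝ = Conn-invariant (Conn G (meeting K) u) here λ p _ x~f y~f u⇝x →
      Conn-trans u⇝x (Conn-edge (∈meeting⁺ x~f (Conn⇒Class K-class p)) x~f y~f)

    v⇝K : ∀ {x} → x ∈ K → Conn G (meeting K) v x
    v⇝K x∈ = let z , z~f₀ , z∈ = ∈meeting⁻ f₀∈ in
      Conn-trans (Conn-edge f₀∈ v~f₀ z~f₀)
        (Conn-trans (Conn-sym (u⇝ (Class⇒Conn K-class z∈))) (u⇝ (Class⇒Conn K-class x∈)))

    K∪v-class : Class (meeting K) v (K ∪ ⁅ v ⁆)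
    K∪v-class w = mk⇔
      (λ w∈ → [ v⇝K , (λ w∈v → subst (Conn G (meeting K) v) (sym (x∈⁅y⁆⇒x≡y v w∈v)) here) ]′ (x∈p∪q⁻ K ⁅ v ⁆ w∈))
      (Conn-invariant (_∈ K ∪ ⁅ v ⁆) (q⊆p∪q K ⁅ v ⁆ (x∈⁅x⁆ v)) λ _ f∈ _ y~f _ → far-end f∈ y~f)

  -- Otherwise `⁅ f ⁆` and its complement, all of which avoids `u`, form a 1-separation. The edge
  -- `g` makes the complement nonempty.
  isolated-InCl : ∀ {f u} → (∀ {g} → Incident G u g → g ≡ f) → ∀ {g} → g ≢ f → InCl M (EdgesMinus G u) f
  isolated-InCl {f} {u} only {g} g≢f = InCl-≤ (+-cancelˡ-≤ 1 _ _ (begin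
    1 + r (EdgesMinus G u ∪ ⁅ f ⁆)    ≤⟨ +-monoʳ-≤ 1 (r-mono _ _ ⊆⊤) ⟩
    1 + r ⊤                           ≡⟨ +-comm 1 _ ⟩
    r ⊤ + 1                           ≤⟨ ≮⇒≥ (λ lt → tc 1 ⁅ f ⁆ (s≤s (s≤s z≤n))
                                           (x∈p⇒0<∣p∣ (x∈⁅x⁆ f) , x∈p⇒0<∣p∣ (x∉p⇒x∈∁p (x≢y⇒x∉⁅y⁆ g≢f)) , lt)) ⟩
    r ⁅ f ⁆ + r (∁ ⁅ f ⁆)             ≤⟨ +-mono-≤ (r-⁅⁆ f) (r-mono _ _ ∁f⊆) ⟩
    1 + r (EdgesMinus G u)            ∎))
    where
    ∁f⊆ : ∁ ⁅ f ⁆ ⊆ EdgesMinus G u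
    ∁f⊆ h∈ = ∈EdgesMinus⁺ λ u~h → x∈∁p⇒x∉p h∈ (subst (_∈ ⁅ f ⁆) (sym (only u~h)) (x∈⁅x⁆ f))

  -- The pair has rank at most one and so gives a 2-separation once two elements, here `a` and `b`,
  -- lie outside it.
  no-parallel : ∀ {f h a b} → f ≢ h → InCl M ⁅ h ⁆ f → a ≢ b → a ∉ ⁅ h ⁆ ∪ ⁅ f ⁆ → ¬ (b ∉ ⁅ h ⁆ ∪ ⁅ f ⁆)
  no-parallel {f} {h} f≢h f∈cl a≢b a∉ b∉ = tc 2 (⁅ h ⁆ ∪ ⁅ f ⁆) (s≤s (s≤s (s≤s z≤n)))
    ( two∈⇒2≤∣p∣ (q⊆p∪q ⁅ h ⁆ ⁅ f ⁆ (x∈⁅x⁆ f)) (p⊆p∪q ⁅ f ⁆ (x∈⁅x⁆ h)) f≢h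
    , two∈⇒2≤∣p∣ (x∉p⇒x∈∁p a∉) (x∉p⇒x∈∁p b∉) a≢b
    , (begin-strict
      r (⁅ h ⁆ ∪ ⁅ f ⁆) + r (∁ (⁅ h ⁆ ∪ ⁅ f ⁆))  ≤⟨ +-mono-≤ (≤-trans (≤-reflexive f∈cl) (r-⁅⁆ h)) (r-mono _ _ ⊆⊤) ⟩
      1 + r ⊤                                    ≡⟨ +-comm 1 _ ⟩
      r ⊤ + 1                                    <⟨ +-monoʳ-< (r ⊤) ≤-refl ⟩
      r ⊤ + 2                                    ∎))

  -- A loop spanned by one component of G - v, and the cycles around it.

  module AnchoredLoop {e v} (loop : LoopAt G v e) (re≡1 : r ⁅ e ⁆ ≡ 1) (A : Anchor e v) where
    open Anchor A

    e≁side : ∀ {x} → x ∈ side → ¬ Incident G x e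
    e≁side x∈ x~e = v∉side (subst (_∈ side) (LoopAt-unique loop x~e) x∈)

    -- Together with `e`, this provides two elements outside `meeting K` for every other component
    -- `K` of G - v, as the size condition on 2-separations requires.
    g₀ : Fin m
    g₀ = proj₁ (anchor-edge re≡1)

    g₀∈ : g₀ ∈ within side
    g₀∈ = proj₂ (anchor-edge re≡1)

    e≢g₀ : e ≢ g₀
    e≢g₀ eq = e≁side (∈within⁻ g₀∈ (inj₁ refl)) (subst (Incident G _) (sym eq) (inj₁ refl))

    module _ {u K} (u≢v : u ≢ v) (u∉side : u ∉ side) (K-class : Class (EdgesMinus G v) u K) where

      e∉meeting : e ∉ meeting K
      e∉meeting e∈ = let x , x~e , x∈ = ∈meeting⁻ e∈ in
        avoids u≢v K-class (subst (_∈ K) (LoopAt-unique loop x~e) x∈)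

      g₀∉meeting : g₀ ∉ meeting K
      g₀∉meeting g₀∈′ = let x , x~g₀ , x∈ = ∈meeting⁻ g₀∈′ in
        Class-disjoint sideClass K-class u∉side (∈within⁻ g₀∈ x~g₀) x∈

      meeting-unique : ∀ {f g} → f ∈ meeting K → g ∈ meeting K → f ≡ g
      meeting-unique = ∣p∣≱2⇒≡ λ big → side-no-separation u≢v K-class big
        (two∈⇒2≤∣p∣ (x∉p⇒x∈∁p e∉meeting) (x∉p⇒x∈∁p g₀∉meeting) e≢g₀)

    -- The side of `f` contains `v`, or lies in `side`, or lies in another component of G - v; the
    -- last case is impossible.
    anchored-loops-parallel : ∀ {u f} → u ≢ v → u ∉ side → LoopAt G u f → r ⁅ f ⁆ ≡ 1 →
                              Anchor f u → r (⁅ f ⁆ ∪ ⁅ e ⁆) ≤ 1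
    anchored-loops-parallel {u} {f} u≢v u∉side loopᶠ rf≡1 anchorᶠ = by-side (v ∈? side₁) (root₁ ∈? side)
      where
      open Anchor anchorᶠ renaming (root to root₁; root≢v to root₁≢u; side to side₁; sideClass to sideClass₁;
        spanned to spanned₁; v∉side to u∉side₁; root∈side to root₁∈side₁; anchor-edge to anchor-edge₁;
        anchored-rank to anchored-rank₁)

      module _ (v∉side₁ : v ∉ side₁) where

        root₁≢v : root₁ ≢ v
        root₁≢v refl = v∉side₁ root₁∈side₁

        side₁-conn : ∀ {x} → x ∈ side₁ → Conn G (EdgesMinus G v) root₁ x
        side₁-conn x∈ = Conn-invariant (Conn G (EdgesMinus G v) root₁) here
          (λ p g∈ x~g y~g root₁⇝x → Conn-trans root₁⇝x (Conn-edge (∈EdgesMinus⁺ λ v~g →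
            v∉side₁ (Class-closed sideClass₁ g∈ x~g v~g (Conn⇒Class sideClass₁ p))) x~g y~g))
          (Class⇒Conn sideClass₁ x∈)

      by-side : Dec (v ∈ side₁) → Dec (root₁ ∈ side) → r (⁅ f ⁆ ∪ ⁅ e ⁆) ≤ 1
      -- `e` is an edge within `⁅ v ⁆`, a subset of the side of `f`, so the anchor of `f` bounds the
      -- rank of both loops together.
      by-side (yes v∈) _ = begin
        r (⁅ f ⁆ ∪ ⁅ e ⁆)              ≤⟨ r-mono _ _ (∪-least ⁅ f ⁆ ⁅ e ⁆ (q⊆p∪q (within ⁅ v ⁆) ⁅ f ⁆) (⁅⁆-⊆
                                            (p⊆p∪q ⁅ f ⁆ (∈within⁺ λ x~e → subst (_∈ ⁅ v ⁆) (sym (LoopAt-unique loop x~e)) (x∈⁅x⁆ v))))) ⟩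
        r (within ⁅ v ⁆ ∪ ⁅ f ⁆)       ≤⟨ anchored-rank₁ loopᶠ (x∈⁅x⁆ v) (⁅⁆-⊆ v∈) ⟩
        ∣ ⁅ v ⁆ ∣                      ≡⟨ ∣⁅x⁆∣≡1 v ⟩
        1                              ∎
      -- The edges within `side` span both loops. Growing from the single vertex `root` with the
      -- pair carried along leaves it rank at most 1.
      by-side (no v∉) (yes root₁∈) = +-cancelʳ-≤ ∣ side ∣ _ _ (begin
        r Y + ∣ side ∣                     ≤⟨ +-monoˡ-≤ ∣ side ∣ (r-mono _ _ (q⊆p∪q (within ⁅ root ⁆) Y)) ⟩
        r (within ⁅ root ⁆ ∪ Y) + ∣ side ∣ ≤⟨ rank-growth sideClass (x∈⁅x⁆ root) (⁅⁆-⊆ root∈side) (λ x∈ _ → avoidY x∈) ⟩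
        r (within side ∪ Y) + ∣ ⁅ root ⁆ ∣ ≤⟨ +-mono-≤ spanY (≤-reflexive (∣⁅x⁆∣≡1 root)) ⟩
        ∣ side ∣ + 1                       ≡⟨ +-comm ∣ side ∣ 1 ⟩
        1 + ∣ side ∣                       ∎)
        where
        Y : Subset m
        Y = ⁅ f ⁆ ∪ ⁅ e ⁆

        avoidY : ∀ {x} → x ∈ side → Y ⊆ EdgesMinus G x
        avoidY x∈ = ∪-least ⁅ f ⁆ ⁅ e ⁆ (⁅⁆-⊆ (loop∈EdgesMinus loopᶠ λ { refl → u∉side x∈ }))
                                        (⁅⁆-⊆ (loop∈EdgesMinus loop λ { refl → v∉side x∈ }))

        side₁⊆side : side₁ ⊆ side
        side₁⊆side x∈ = Conn⇒Class sideClass (Conn-trans (Class⇒Conn sideClass root₁∈) (side₁-conn v∉ x∈))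

        f∈cl-side : InCl M (within side) f
        f∈cl-side = InCl-mono (within-mono side₁⊆side) spanned₁

        spanY : r (within side ∪ Y) ≤ ∣ side ∣
        spanY = begin
          r (within side ∪ Y)                  ≤⟨ r-mono _ _ (∪-least (within side) Y (p⊆p∪q ⁅ e ⁆ ∘ p⊆p∪q ⁅ f ⁆)
                                                    (∪-least ⁅ f ⁆ ⁅ e ⁆ (p⊆p∪q ⁅ e ⁆ ∘ q⊆p∪q (within side) ⁅ f ⁆)
                                                      (q⊆p∪q (within side ∪ ⁅ f ⁆) ⁅ e ⁆))) ⟩
          r ((within side ∪ ⁅ f ⁆) ∪ ⁅ e ⁆)    ≡⟨ InCl-mono (p⊆p∪q ⁅ f ⁆) spanned ⟩
          r (within side ∪ ⁅ f ⁆)              ≡⟨ f∈cl-side ⟩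
          r (within side)                      ≤⟨ class-rank sideClass ⟩
          ∣ side ∣                             ∎
      -- The component containing the side of `f` meets a single edge `h`, so `h` spans `f`, while
      -- `e` and `g₀` are two further elements.
      by-side (no v∉) (no root₁∉) with class (EdgesMinus G v) root₁ | anchor-edge₁ rf≡1
      ... | K₂ , K₂-class | h , h∈ = ⊥-elim (no-parallel f≢h f∈clh e≢g₀ e∉ g₀∉)
        where
        within⊆meeting : within side₁ ⊆ meeting K₂
        within⊆meeting g∈ = ∈meeting⁺ (inj₁ refl) (Conn⇒Class K₂-class (side₁-conn v∉ (∈within⁻ g∈ (inj₁ refl))))

        f∈clh : InCl M ⁅ h ⁆ f
        f∈clh = InCl-mono (λ g∈ → subst (_∈ ⁅ h ⁆)
          (meeting-unique (root₁≢v v∉) root₁∉ K₂-class (within⊆meeting h∈) (within⊆meeting g∈)) (x∈⁅x⁆ h)) spanned₁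

        f≢h : f ≢ h
        f≢h refl = u∉side₁ (∈within⁻ h∈ (inj₁ (proj₁ loopᶠ)))

        outside-pair : ∀ {g} → g ∉ meeting K₂ → g ≢ f → g ∉ ⁅ h ⁆ ∪ ⁅ f ⁆
        outside-pair g∉ g≢f g∈ = [ (λ g∈h → g∉ (subst (_∈ meeting K₂) (sym (x∈⁅y⁆⇒x≡y h g∈h)) (within⊆meeting h∈)))
                                 , (λ g∈f → g≢f (x∈⁅y⁆⇒x≡y f g∈f)) ]′ (x∈p∪q⁻ ⁅ h ⁆ ⁅ f ⁆ g∈)

        e∉ : e ∉ ⁅ h ⁆ ∪ ⁅ f ⁆
        e∉ = outside-pair (e∉meeting (root₁≢v v∉) root₁∉ K₂-class)
          λ { refl → u≢v (LoopAt-unique loop (inj₁ (proj₁ loopᶠ))) }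

        g₀∉ : g₀ ∉ ⁅ h ⁆ ∪ ⁅ f ⁆
        g₀∉ = outside-pair (g₀∉meeting (root₁≢v v∉) root₁∉ K₂-class)
          λ g₀≡f → u∉side (∈within⁻ g₀∈ (subst (Incident G u) (sym g₀≡f) (inj₁ (proj₁ loopᶠ))))

    isolated-loop-parallel : ∀ {u f} → u ≢ v → u ∉ side → LoopAt G u f →
                             InCl M (EdgesMinus G u) f → r (⁅ f ⁆ ∪ ⁅ e ⁆) ≤ 1
    isolated-loop-parallel {f = f} u≢v u∉side loopᶠ f∈cl with r ⁅ f ⁆ ℕ.≟ 1
    -- Here `f` has rank 0, and adding `e` raises the rank by at most 1.
    ... | no rf≢1 = ≤-trans (r-∪-⁅⁆ ⁅ f ⁆ e) (≤∧≢⇒< (r-⁅⁆ f) rf≢1)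
    ... | yes rf≡1 = anchored-loops-parallel u≢v u∉side loopᶠ rf≡1 (anchor loopᶠ rf≡1 f∈cl)

    -- If `C` passes through `v` or lies in `side`, the number of its vertices bounds the rank, and
    -- a leafless set has at least as many edges. A cycle in another component of G - v is a single
    -- loop.
    cycle-spans : ∀ {C} → Cycle G C → r (C ∪ ⁅ e ⁆) ≤ ∣ C ∣
    cycle-spans {C} cyc@((f₀ , f₀∈) , conn , _) with v ∈? vertices C
    ... | yes v∈ = begin
      r (C ∪ ⁅ e ⁆)             ≤⟨ r-mono _ _ (∪-least C ⁅ e ⁆ (λ f∈ → ∈within⁺ (∈vertices⁺ f∈)) (⁅⁆-⊆
                                     (∈within⁺ λ x~e → subst (_∈ vertices C) (sym (LoopAt-unique loop x~e)) v∈))) ⟩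
      r (within (vertices C))   ≤⟨ connected-rank v∈ v⇝ ⟩
      ∣ vertices C ∣            ≤⟨ ∣vertices∣≤ (Cycle⇒Leafless cyc) ⟩
      ∣ C ∣                     ∎
      where
      v⇝ : ∀ {x} → x ∈ vertices C → Conn G ⊤ v x
      v⇝ x∈ = let f , f∈ , v~f = ∈vertices⁻ v∈
                  g , g∈ , x~g = ∈vertices⁻ {C} x∈
              in Conn-mono ⊆⊤ (Conn-trans (Conn-edge f∈ v~f (inj₁ refl))
                   (Conn-trans (conn f g f∈ g∈) (Conn-edge g∈ (inj₁ refl) x~g)))
    ... | no v∉ = by-side (u ∈? side)
      where
      u : Fin n
      u = end₁ G f₀

      u≢v : u ≢ v
      u≢v u≡v = v∉ (∈vertices⁺ f₀∈ (inj₁ u≡v))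

      C-avoids-v : C ⊆ EdgesMinus G v
      C-avoids-v f∈ = ∈EdgesMinus⁺ λ v~f → v∉ (∈vertices⁺ f∈ v~f)

      u⇝ : ∀ {x} → x ∈ vertices C → Conn G (EdgesMinus G v) u x
      u⇝ x∈ = let g , g∈ , x~g = ∈vertices⁻ {C} x∈
              in Conn-mono C-avoids-v (Conn-trans (conn f₀ g f₀∈ g∈) (Conn-edge g∈ (inj₁ refl) x~g))

      by-side : Dec (u ∈ side) → r (C ∪ ⁅ e ⁆) ≤ ∣ C ∣
      by-side (yes u∈) = begin
        r (C ∪ ⁅ e ⁆)                     ≤⟨ r-mono _ _ (∪-monoˡ-⊆ C _ ⁅ e ⁆ λ f∈ → ∈within⁺ (∈vertices⁺ f∈)) ⟩
        r (within (vertices C) ∪ ⁅ e ⁆)   ≤⟨ anchored-rank loop (∈vertices⁺ f₀∈ (inj₁ refl))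
                                               (λ x∈ → Conn⇒Class sideClass (Conn-trans (Class⇒Conn sideClass u∈) (u⇝ x∈))) ⟩
        ∣ vertices C ∣                    ≤⟨ ∣vertices∣≤ (Cycle⇒Leafless cyc) ⟩
        ∣ C ∣                             ∎
      -- Only `f₀` meets the component of `u`, so `C` is `⁅ f₀ ⁆`. As the sole edge at `u` it lies
      -- in the closure of E(G - u) by 3-connectivity, and axiom (3) then makes it a loop.
      by-side (no u∉) with class (EdgesMinus G v) u
      ... | K , K-class = begin
        r (C ∪ ⁅ e ⁆)        ≤⟨ r-mono _ _ (∪-monoˡ-⊆ C ⁅ f₀ ⁆ ⁅ e ⁆ C⊆f₀) ⟩
        r (⁅ f₀ ⁆ ∪ ⁅ e ⁆)   ≤⟨ isolated-loop-parallel u≢v u∉ f₀-loop f₀∈cl ⟩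
        1                    ≤⟨ x∈p⇒0<∣p∣ f₀∈ ⟩
        ∣ C ∣                ∎
        where
        meets : ∀ {f x} → Incident G x f → Conn G (EdgesMinus G v) u x → f ≡ f₀
        meets x~f u⇝x = meeting-unique u≢v u∉ K-class
          (∈meeting⁺ x~f (Conn⇒Class K-class u⇝x)) (∈meeting⁺ (inj₁ refl) (Conn⇒Class K-class here))

        C⊆f₀ : C ⊆ ⁅ f₀ ⁆
        C⊆f₀ f∈ = subst (_∈ ⁅ f₀ ⁆) (sym (meets (inj₁ refl) (u⇝ (∈vertices⁺ f∈ (inj₁ refl))))) (x∈⁅x⁆ f₀)

        f₀∈cl : InCl M (EdgesMinus G u) f₀
        f₀∈cl = isolated-InCl (λ u~g → meets u~g here) {e}
          λ { refl → u≢v (LoopAt-unique loop (inj₁ refl)) }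

        f₀-loop : LoopAt G u f₀
        f₀-loop = [ (λ f₀∈′ → ⊥-elim (∈EdgesMinus⁻ f₀∈′ (inj₁ refl))) , id ]′ (closure _ _ f₀∈cl)

-- Independence compared with the condition on cycles.

module SparseSets {n m : ℕ} (G : Graph n m) (M : Matroid m) (fw : Framework G M) where
  open Matroid M
  open MatroidProperties M
  open GraphProperties G
  open FrameworkProperties G M fw

  Sparse : Subset m → Set
  Sparse I = (∀ C → C ⊆ I → ¬ Balanced G M C)
           × (∀ C D → C ⊆ I → D ⊆ I → Cycle G C → Cycle G D → C ≡ D)

  Sparse-⊆ : ∀ {I J} → J ⊆ I → Sparse I → Sparse J
  Sparse-⊆ J⊆I (unbalanced , unique) =
    (λ C C⊆ → unbalanced C (J⊆I ∘ C⊆)) , λ C D C⊆ D⊆ → unique C D (J⊆I ∘ C⊆) (J⊆I ∘ D⊆)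

  -- At a leaf `x`, the rest of `C` avoids `x`, so by axiom (3) it does not span the nonloop `f`.
  -- Being independent, it would stay so with `f` added.
  Circuit⇒Leafless : ∀ {C} → Circuit M C → Leafless C
  Circuit⇒Leafless {C} (dependent , minimal) x deg≡1 with leafEdge {C} {x} deg≡1
  ... | f , f∈ , x~f , ¬loop , unique = dependent (Independent-remove f∈
    (minimal (C - f) (p-x⊆p C f , f , f∈ , x∉p-x f C))
    (nonloop∉cl x~f ¬loop λ g∈ → ∈EdgesMinus⁺ λ x~g → x∈p-y⇒x≢y C g∈ (unique (p-x⊆p C f g∈) x~g)))

  -- By induction on size a dependent `I` would be a circuit. It is leafless with at most one cycle,
  -- hence is itself a balanced cycle.
  Sparse⇒Independent : ∀ {I} → Sparse I → Independent M I
  Sparse⇒Independent {I₀} = go _ I₀ ≤-refl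
    where
    go : ∀ k I → ∣ I ∣ ≤ k → Sparse I → Independent M I
    go k I ∣I∣≤ sparse with nonempty? I
    go k I ∣I∣≤ sparse | no ¬ne = trans (Empty⇒r≡0 ¬ne) (sym (Empty⇒∣∣≡0 ¬ne))
    go zero I ∣I∣≤ sparse | yes (_ , f∈) with () ← ≤-trans (x∈p⇒0<∣p∣ f∈) ∣I∣≤
    go (suc k) I ∣I∣≤ sparse | yes ne with Independent? I
    ... | yes ind = ind
    ... | no dependent = ⊥-elim (proj₁ sparse I id (cycle , circuit))
      where
      circuit : Circuit M I
      circuit = dependent , λ D D⊂ →
        go k D (≤-pred (≤-trans (p⊂q⇒∣p∣<∣q∣ D⊂) ∣I∣≤)) (Sparse-⊆ (proj₁ D⊂) sparse)

      cycle : Cycle G I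
      cycle = Leafless∧unique⇒Cycle ne (Circuit⇒Leafless circuit) (proj₂ sparse)

  Independent⇒unbalanced : ∀ {I} → Independent M I → ∀ C → C ⊆ I → ¬ Balanced G M C
  Independent⇒unbalanced ind C C⊆ (_ , dependent , _) = dependent (Independent-⊆ C⊆ ind)

  -- A dependent singleton is a circuit, since its proper subsets are empty, and a loop is a cycle.
  unbalanced-loop-rank : ∀ {v e} → LoopAt G v e → ¬ Balanced G M ⁅ e ⁆ → r ⁅ e ⁆ ≡ 1
  unbalanced-loop-rank {v} {e} loop unbalanced with Independent? ⁅ e ⁆
  ... | yes ind = trans ind (∣⁅x⁆∣≡1 e)
  ... | no dependent = ⊥-elim (unbalanced (LoopAt⇒Cycle loop , dependent , λ D (D⊆ , x , x∈ , x∉D) →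
    let empty = λ (y , y∈) → x∉D (subst (_∈ D) (trans (x∈⁅y⁆⇒x≡y e (D⊆ y∈)) (sym (x∈⁅y⁆⇒x≡y e x∈))) y∈)
    in trans (Empty⇒r≡0 empty) (sym (Empty⇒∣∣≡0 empty))))

  loop∈Cycle : ∀ {v e C} → LoopAt G v e → Cycle G C → e ∈ C → C ≡ ⁅ e ⁆
  loop∈Cycle {e = e} loop cyc e∈ = ⊆-antisym
    (Cycle-minimal cyc (⁅⁆-⊆ e∈) (e , x∈⁅x⁆ e) (Cycle⇒Leafless (LoopAt⇒Cycle loop))) (⁅⁆-⊆ e∈)

  module _ {e v} (loop : LoopAt G v e) (unbalanced : ¬ Balanced G M ⁅ e ⁆)
           (spans : ∀ {C} → Cycle G C → r (C ∪ ⁅ e ⁆) ≤ ∣ C ∣) where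
    open ≤-Reasoning

    -- Adding `e` to `C` or to `D` gives rank at most the size of that cycle. Both enlarged sets
    -- contain `(C ∩ D) ∪ ⁅ e ⁆`, which is independent and has one element more than `C ∩ D`; this
    -- excess contradicts submodularity.
    cycles-nested : ∀ {C D} → Cycle G C → Cycle G D → Independent M (C ∪ D) → C ⊆ D
    cycles-nested {C} {D} cycC cycD ind {c} c∈C with c ∈? D
    ... | yes c∈D = c∈D
    ... | no c∉D = ⊥-elim (<-irrefl refl (begin-strict
      ∣ C ∪ D ∣ + ∣ C ∩ D ∣                                      <⟨ +-monoʳ-< ∣ C ∪ D ∣ ≤-refl ⟩
      ∣ C ∪ D ∣ + suc ∣ C ∩ D ∣                                  ≡⟨ cong₂ _+_ ind (trans indF (∣p∪x∣ e∉F)) ⟨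
      r (C ∪ D) + r ((C ∩ D) ∪ ⁅ e ⁆)                            ≤⟨ +-mono-≤ (r-mono _ _ ∪⊆) (r-mono _ _ ∩⊆) ⟩
      r (Cₑ ∪ Dₑ) + r (Cₑ ∩ Dₑ)                                  ≤⟨ r-submod Cₑ Dₑ ⟩
      r Cₑ + r Dₑ                                                ≤⟨ +-mono-≤ (spans cycC) (spans cycD) ⟩
      ∣ C ∣ + ∣ D ∣                                              ≡⟨ ∣p∪q∣+∣p∩q∣ C D ⟨
      ∣ C ∪ D ∣ + ∣ C ∩ D ∣                                      ∎))
      where
      Cₑ Dₑ : Subset m
      Cₑ = C ∪ ⁅ e ⁆
      Dₑ = D ∪ ⁅ e ⁆

      ∪⊆ : C ∪ D ⊆ Cₑ ∪ Dₑ
      ∪⊆ = ∪-least C D (p⊆p∪q Dₑ ∘ p⊆p∪q ⁅ e ⁆) (q⊆p∪q Cₑ Dₑ ∘ p⊆p∪q ⁅ e ⁆)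

      ∩⊆ : (C ∩ D) ∪ ⁅ e ⁆ ⊆ Cₑ ∩ Dₑ
      ∩⊆ = ∪-least (C ∩ D) ⁅ e ⁆
        (λ f∈ → x∈p∩q⁺ (p⊆p∪q ⁅ e ⁆ (p∩q⊆p C D f∈) , p⊆p∪q ⁅ e ⁆ (p∩q⊆q C D f∈)))
        (λ f∈ → x∈p∩q⁺ (q⊆p∪q C ⁅ e ⁆ f∈ , q⊆p∪q D ⁅ e ⁆ f∈))

      -- A cycle containing the loop `e` is `⁅ e ⁆`, so `C` would lie in `D`, against `c∉D`.
      e∉F : e ∉ C ∩ D
      e∉F e∈ = c∉D (⁅⁆-⊆ (p∩q⊆q C D e∈) (subst (c ∈_) (loop∈Cycle loop cycC (p∩q⊆p C D e∈)) c∈C))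

      -- A cycle avoiding `e` lies in `C ∩ D` and by minimality contains all of `C`, which would put
      -- `c` in `D`.
      only-loop : ∀ {B} → B ⊆ (C ∩ D) ∪ ⁅ e ⁆ → Cycle G B → B ≡ ⁅ e ⁆
      only-loop {B} B⊆ cycB with e ∈? B
      ... | yes e∈B = loop∈Cycle loop cycB e∈B
      ... | no e∉B = ⊥-elim (c∉D (p∩q⊆q C D (B⊆F
        (Cycle-minimal cycC (p∩q⊆p C D ∘ B⊆F) (proj₁ cycB) (Cycle⇒Leafless cycB) c∈C))))
        where
        B⊆F : B ⊆ C ∩ D
        B⊆F f∈ = [ id , (λ f∈e → ⊥-elim (e∉B (subst (_∈ B) (x∈⁅y⁆⇒x≡y e f∈e) f∈))) ]′ (x∈p∪q⁻ (C ∩ D) ⁅ e ⁆ (B⊆ f∈))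

      indF : Independent M ((C ∩ D) ∪ ⁅ e ⁆)
      indF = Sparse⇒Independent
        ( (λ B B⊆ bal → unbalanced (subst (Balanced G M) (only-loop B⊆ (proj₁ bal)) bal))
        , λ B B′ B⊆ B′⊆ cyc cyc′ → trans (only-loop B⊆ cyc) (sym (only-loop B′⊆ cyc′)))

    Independent⇒Sparse : ∀ {I} → Independent M I → Sparse I
    Independent⇒Sparse ind = Independent⇒unbalanced ind , λ C D C⊆ D⊆ cycC cycD → ⊆-antisym
      (cycles-nested cycC cycD (Independent-⊆ (∪-least C D C⊆ D⊆) ind))
      (cycles-nested cycD cycC (Independent-⊆ (∪-least D C D⊆ C⊆) ind))

theorem7p1 : ∀ {n m : ℕ} (G : Graph n m) (M : Matroid m) →
    Framework G M → ThreeConnected M →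
    (e : Fin m) (v : Fin n) → LoopAt G v e → ¬ Balanced G M ⁅ e ⁆ →
    InCl M (EdgesMinus G v) e →
    ∀ (I : Subset m) →
    Independent M I ⇔
    ((∀ C → C ⊆ I → ¬ Balanced G M C)
    × (∀ C D → C ⊆ I → D ⊆ I → Cycle G C → Cycle G D → C ≡ D))
theorem7p1 G M fw tc e v loop unbalanced e∈cl I =
  mk⇔ (Independent⇒Sparse loop unbalanced cycle-spans) Sparse⇒Independent
  where
  open SparseSets G M fw
  open ThreeConnectedFramework G M fw tc

  re≡1 : Matroid.r M ⁅ e ⁆ ≡ 1
  re≡1 = unbalanced-loop-rank loop unbalanced

  open AnchoredLoop loop re≡1 (FrameworkProperties.anchor G M fw loop re≡1 e∈cl)
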